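{- For every $\alpha>1$, the runtime of LOHification of rank $\alpha$ is in $$\Omega\left(n\log\left(\frac{1}{\alpha-1}\right)+\frac{n\cdot\alpha\cdot\log(\alpha)}{\alpha-1}\right).$$
   Context: Layer-ordered heap (LOH) of rank $\alpha\ge 1$ on $n$ elements: a partition of an array of $n$ mutually comparable (distinct) values into consecutive layers $L_0\le L_1\le\cdots\le L_{\ell-1}$ (every element of $L_i$ is $\le$ every element of $L_{i+1}$), each layer being internally unordered. With pivots $p_i=\left\lceil\sum_{j=0}^{i}\alpha^j\right\rceil$, the layer sizes are $|L_0|=p_0=1$, $|L_i|=p_i-p_{i-1}$, and the last layer contains the remaining elements beyond the last pivot that is at most $n$. LOHification of rank $\alpha$ is the problem of rearranging an arbitrary array of length $n$ into a LOH of rank $\alpha$. The lower bound is for the worst-case runtime of any comparison-based algorithm (decision-tree model), asymptotically as $n\to\infty$. -}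

module Defs where

open import Data.Bool.Base using (Bool; if_then_else_)
open import Data.Fin.Base using (Fin; toℕ)
open import Data.Fin.Permutation using (Permutation′; _⟨$⟩ʳ_)
open import Data.Integer.Base as ℤ using (ℤ; +_; -[1+_])
open import Data.Nat.Base as ℕ using (ℕ; zero; suc)
import Data.Nat.Properties as ℕ
open import Data.Product.Base using (Σ-syntax; ∃-syntax; _×_; _,_)
open import Data.Rational.Base
open import Data.Rational.Properties
open import Data.Rational.Solver using (module +-*-Solver)
open import Function.Definitions using (Injective)
open import Relation.Binary.PropositionalEquality
  using (_≡_; refl; sym; trans; cong; cong₂; subst; subst₂)
open import Relation.Nullary.Decidable.Core using (does)
open import Relation.Nullary.Negation.Core using (¬_)

------------------------------------------------------------------------
-- Real numbers as Cauchy sequences of rationals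

IsCauchy : (ℕ → ℚ) → Set
IsCauchy s = ∀ ε → 0ℚ < ε →
  ∃[ N ] (∀ m n → N ℕ.≤ m → N ℕ.≤ n → ∣ s m - s n ∣ < ε)

record ℝ : Set where
  constructor mkℝ
  field
    seq      : ℕ → ℚ
    isCauchy : IsCauchy seq

open ℝ public

private
  half-pos : ∀ {ε} → 0ℚ < ε → 0ℚ < ½ * ε
  half-pos {ε} 0<ε =
    subst (_< ½ * ε) (*-zeroʳ ½) (*-monoʳ-<-pos ½ 0<ε)

  half+half : ∀ ε → ½ * ε + ½ * ε ≡ ε
  half+half ε = trans (sym (*-distribʳ-+ ε ½ ½)) (*-identityˡ ε)

  *-pos : ∀ p q → 0ℚ < p → 0ℚ < q → 0ℚ < p * q
  *-pos p q 0<p 0<q =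
    subst (_< p * q) (*-zeroʳ p) (*-monoʳ-<-pos p {{positive 0<p}} 0<q)

  1/-pos : ∀ {p} (0<p : 0ℚ < p) → 0ℚ < (1/ p) {{>-nonZero 0<p}}
  1/-pos {p} 0<p = positive⁻¹ _ {{1/pos⇒pos p {{positive 0<p}}}}

  *-mono-≤-nonNeg : ∀ {p q r s} → 0ℚ ≤ r → 0ℚ ≤ q →
                    p ≤ q → r ≤ s → p * r ≤ q * s
  *-mono-≤-nonNeg {p} {q} {r} {s} 0≤r 0≤q p≤q r≤s = ≤-trans
    (*-monoʳ-≤-nonNeg r {{nonNegative 0≤r}} p≤q)
    (*-monoˡ-≤-nonNeg q {{nonNegative 0≤q}} r≤s)

  ∣p-p∣≡0 : ∀ p → ∣ p - p ∣ ≡ 0ℚ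
  ∣p-p∣≡0 p = cong ∣_∣ (+-inverseʳ p)

  const-cauchy : ∀ q → IsCauchy (λ _ → q)
  const-cauchy q ε 0<ε =
    0 , λ _ _ _ _ → subst (_< ε) (sym (∣p-p∣≡0 q)) 0<ε

  +-cauchy : ∀ {s t} → IsCauchy s → IsCauchy t → IsCauchy (λ n → s n + t n)
  +-cauchy {s} {t} cs ct ε 0<ε
    with M , hM ← cs (½ * ε) (half-pos 0<ε)
    with N , hN ← ct (½ * ε) (half-pos 0<ε) =
    M ℕ.⊔ N , λ m n ≤m ≤n →
      subst₂ _<_
        (cong ∣_∣ (sym (shuffle (s m) (t m) (s n) (t n))))
        (half+half ε)
        (≤-<-trans (∣p+q∣≤∣p∣+∣q∣ (s m - s n) (t m - t n))
          (+-mono-< (hM m n (ℕ.m⊔n≤o⇒m≤o M N ≤m) (ℕ.m⊔n≤o⇒m≤o M N ≤n))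
                    (hN m n (ℕ.m⊔n≤o⇒n≤o M N ≤m) (ℕ.m⊔n≤o⇒n≤o M N ≤n))))
    where
    shuffle : ∀ a b c d → (a + b) - (c + d) ≡ (a - c) + (b - d)
    shuffle = solve 4 (λ a b c d →
      ((a :+ b) :- (c :+ d)) := ((a :- c) :+ (b :- d))) refl
      where open +-*-Solver

  neg-cauchy : ∀ {s} → IsCauchy s → IsCauchy (λ n → - s n)
  neg-cauchy {s} cs ε 0<ε with N , hN ← cs ε 0<ε =
    N , λ m n ≤m ≤n → subst (_< ε)
      (trans (sym (∣-p∣≡∣p∣ (s m - s n)))
             (cong ∣_∣ (neg-distrib-+ (s m) (- s n))))
      (hN m n ≤m ≤n)

  Bounded : (ℕ → ℚ) → Set
  Bounded s = ∃[ B ] 0ℚ < B × ∃[ N ] (∀ n → N ℕ.≤ n → ∣ s n ∣ ≤ B)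

  bounded : ∀ {s} → IsCauchy s → Bounded s
  bounded {s} cs with N , hN ← cs 1ℚ (positive⁻¹ 1ℚ) =
      1ℚ + ∣ s N ∣
    , <-≤-trans (positive⁻¹ 1ℚ)
        (subst (_≤ 1ℚ + ∣ s N ∣) (+-identityʳ 1ℚ)
          (+-monoʳ-≤ 1ℚ (0≤∣p∣ (s N))))
    , N
    , λ n ≤n → ≤-trans
        (subst (_≤ ∣ s n - s N ∣ + ∣ s N ∣)
          (cong ∣_∣ (cancel (s n) (s N)))
          (∣p+q∣≤∣p∣+∣q∣ (s n - s N) (s N)))
        (+-monoˡ-≤ ∣ s N ∣ (<⇒≤ (hN n N ≤n ℕ.≤-refl)))
    where
    cancel : ∀ a b → (a - b) + b ≡ a
    cancel = solve 2 (λ a b → ((a :- b) :+ b) := a) refl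
      where open +-*-Solver

  ½ε/ : ∀ {B} (ε : ℚ) → 0ℚ < B → ℚ
  ½ε/ {B} ε 0<B = ½ * ε * (1/ B) {{>-nonZero 0<B}}

  ½ε/-pos : ∀ {B ε} (0<B : 0ℚ < B) → 0ℚ < ε → 0ℚ < ½ε/ ε 0<B
  ½ε/-pos {B} {ε} 0<B 0<ε =
    *-pos (½ * ε) ((1/ B) {{>-nonZero 0<B}}) (half-pos 0<ε) (1/-pos 0<B)

  *-small : ∀ {B} ε p q (0<B : 0ℚ < B) → ∣ q ∣ ≤ B →
            ∣ p ∣ < ½ε/ ε 0<B → ∣ p * q ∣ < ½ * ε
  *-small {B} ε p q 0<B q≤B p< = subst₂ _<_
    (sym (∣p*q∣≡∣p∣*∣q∣ p q))
    (trans (*-assoc (½ * ε) (1/ B) B)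
      (trans (cong (½ * ε *_) (*-inverseˡ B)) (*-identityʳ (½ * ε))))
    (≤-<-trans
      (*-monoˡ-≤-nonNeg ∣ p ∣ {{nonNegative (0≤∣p∣ p)}} q≤B)
      (*-monoˡ-<-pos B {{positive 0<B}} p<))
    where instance _ = >-nonZero 0<B

  *-close : ∀ {A B} ε a b c d (0<A : 0ℚ < A) (0<B : 0ℚ < B) →
            ∣ a ∣ ≤ A → ∣ d ∣ ≤ B →
            ∣ a - c ∣ < ½ε/ ε 0<B → ∣ b - d ∣ < ½ε/ ε 0<A →
            ∣ a * b - c * d ∣ < ε
  *-close ε a b c d 0<A 0<B a≤A d≤B a-c< b-d< = subst₂ _<_
    (cong ∣_∣ (sym (split a b c d)))
    (half+half ε)
    (≤-<-trans
      (∣p+q∣≤∣p∣+∣q∣ ((b - d) * a) ((a - c) * d))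
      (+-mono-< (*-small ε (b - d) a 0<A a≤A b-d<)
                (*-small ε (a - c) d 0<B d≤B a-c<)))
    where
    split : ∀ a b c d → a * b - c * d ≡ (b - d) * a + (a - c) * d
    split = solve 4 (λ a b c d →
      ((a :* b) :- (c :* d)) := (((b :- d) :* a) :+ ((a :- c) :* d))) refl
      where open +-*-Solver

  *-cauchy′ : ∀ {s t} → Bounded s → Bounded t → IsCauchy s → IsCauchy t →
              IsCauchy (λ n → s n * t n)
  *-cauchy′ {s} {t} (A , 0<A , K , hK) (B , 0<B , L , hL) cs ct ε 0<ε =
    combine (cs (½ε/ ε 0<B) (½ε/-pos 0<B 0<ε))
            (ct (½ε/ ε 0<A) (½ε/-pos 0<A 0<ε))
    where
    Within : (ℕ → ℚ) → ℚ → ℕ → Set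
    Within u η N = ∀ m n → N ℕ.≤ m → N ℕ.≤ n → ∣ u m - u n ∣ < η

    combine : ∃[ M ] Within s (½ε/ ε 0<B) M → ∃[ N ] Within t (½ε/ ε 0<A) N →
              ∃[ N ] Within (λ n → s n * t n) ε N
    combine (M , hM) (N , hN) = (K ℕ.⊔ L) ℕ.⊔ (M ℕ.⊔ N) , λ m n ≤m ≤n →
      let m₁ = ℕ.m⊔n≤o⇒m≤o (K ℕ.⊔ L) (M ℕ.⊔ N) ≤m
          m₂ = ℕ.m⊔n≤o⇒n≤o (K ℕ.⊔ L) (M ℕ.⊔ N) ≤m
          n₁ = ℕ.m⊔n≤o⇒m≤o (K ℕ.⊔ L) (M ℕ.⊔ N) ≤n
          n₂ = ℕ.m⊔n≤o⇒n≤o (K ℕ.⊔ L) (M ℕ.⊔ N) ≤n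
      in *-close ε (s m) (t m) (s n) (t n) 0<A 0<B
           (hK m (ℕ.m⊔n≤o⇒m≤o K L m₁))
           (hL n (ℕ.m⊔n≤o⇒n≤o K L n₁))
           (hM m n (ℕ.m⊔n≤o⇒m≤o M N m₂) (ℕ.m⊔n≤o⇒m≤o M N n₂))
           (hN m n (ℕ.m⊔n≤o⇒n≤o M N m₂) (ℕ.m⊔n≤o⇒n≤o M N n₂))

  *-cauchy : ∀ {s t} → IsCauchy s → IsCauchy t → IsCauchy (λ n → s n * t n)
  *-cauchy {s} {t} cs ct =
    *-cauchy′ {s} {t} (bounded {s} cs) (bounded {t} ct) cs ct

fromℚ : ℚ → ℝ
fromℚ q = mkℝ (λ _ → q) (const-cauchy q)

fromℕ : ℕ → ℝ
fromℕ n = fromℚ (+ n / 1)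

0ℝ 1ℝ : ℝ
0ℝ = fromℚ 0ℚ
1ℝ = fromℚ 1ℚ

infixl 6 _+ᵣ_ _-ᵣ_
infixl 7 _*ᵣ_
infixr 8 _^ᵣ_
infix  4 _<ᵣ_ _≤ᵣ_

_+ᵣ_ _-ᵣ_ _*ᵣ_ : ℝ → ℝ → ℝ
mkℝ s cs +ᵣ mkℝ t ct = mkℝ (λ n → s n + t n) (+-cauchy {s} {t} cs ct)
mkℝ s cs -ᵣ mkℝ t ct =
  mkℝ (λ n → s n - t n) (+-cauchy {s} {λ n → - t n} cs (neg-cauchy {t} ct))
mkℝ s cs *ᵣ mkℝ t ct = mkℝ (λ n → s n * t n) (*-cauchy {s} {t} cs ct)

_^ᵣ_ : ℝ → ℕ → ℝ
x ^ᵣ zero  = 1ℝ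
x ^ᵣ suc n = x *ᵣ x ^ᵣ n

-- Bounded away from zero; being positive termwise would not be enough.
Positiveᵣ : ℝ → Set
Positiveᵣ x = ∃[ δ ] 0ℚ < δ × ∃[ N ] (∀ n → N ℕ.≤ n → δ ≤ seq x n)

_<ᵣ_ _≤ᵣ_ : ℝ → ℝ → Set
x <ᵣ y = Positiveᵣ (y -ᵣ x)
x ≤ᵣ y = ¬ (y <ᵣ x)

private
  1/₊ : ∀ a → 0ℚ < a → ℚ
  1/₊ a 0<a = (1/ a) {{>-nonZero 0<a}}

  1/₊-antimono : ∀ {a b} (0<a : 0ℚ < a) (0<b : 0ℚ < b) →
                 a ≤ b → 1/₊ b 0<b ≤ 1/₊ a 0<a
  1/₊-antimono {a} {b} 0<a 0<b a≤b = subst₂ _≤_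
    (trans (*-assoc (1/ b) a (1/ a))
      (trans (cong ((1/ b) *_) (*-inverseʳ a)) (*-identityʳ (1/ b))))
    (trans (cong (_* (1/ a)) (*-inverseˡ b)) (*-identityˡ (1/ a)))
    (*-monoʳ-≤-nonNeg (1/ a) {{nonNegative (<⇒≤ (1/-pos 0<a))}}
      (*-monoˡ-≤-nonNeg (1/ b) {{nonNegative (<⇒≤ (1/-pos 0<b))}} a≤b))
    where
    instance
      _ = >-nonZero 0<a
      _ = >-nonZero 0<b

  1/₊-diff : ∀ {a b} (0<a : 0ℚ < a) (0<b : 0ℚ < b) →
             1/₊ a 0<a - 1/₊ b 0<b ≡ (b - a) * (1/₊ a 0<a * 1/₊ b 0<b)
  1/₊-diff {a} {b} 0<a 0<b = sym (trans
    (expand b a (1/ a) (1/ b))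
    (trans
      (cong₂ (λ p q → (1/ a) * p - (1/ b) * q) (*-inverseʳ b) (*-inverseʳ a))
      (cong₂ _-_ (*-identityʳ (1/ a)) (*-identityʳ (1/ b)))))
    where
    instance
      _ = >-nonZero 0<a
      _ = >-nonZero 0<b

    expand : ∀ a b c d → (a - b) * (c * d) ≡ c * (a * d) - d * (b * c)
    expand = solve 4 (λ a b c d →
      ((a :- b) :* (c :* d)) := ((c :* (a :* d)) :- (d :* (b :* c)))) refl
      where open +-*-Solver

  1/₊-close : ∀ {δ a b} ε (0<δ : 0ℚ < δ) (0<a : 0ℚ < a) (0<b : 0ℚ < b) →
              δ ≤ a → δ ≤ b → ∣ b - a ∣ < ε * (δ * δ) →
              ∣ 1/₊ a 0<a - 1/₊ b 0<b ∣ < ε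
  1/₊-close {δ} {a} {b} ε 0<δ 0<a 0<b δ≤a δ≤b b-a< = subst₂ _<_
    (sym (trans (cong ∣_∣ (1/₊-diff 0<a 0<b))
      (trans (∣p*q∣≡∣p∣*∣q∣ (b - a) (1/a * 1/b))
        (cong (∣ b - a ∣ *_)
          (0≤p⇒∣p∣≡p (<⇒≤ (*-pos 1/a 1/b (1/-pos 0<a) (1/-pos 0<b))))))))
    (trans (regroup ε δ 1/δ)
      (trans (cong (λ p → ε * (p * p)) (*-inverseʳ δ {{>-nonZero 0<δ}}))
             (*-identityʳ ε)))
    (≤-<-trans
      (*-monoˡ-≤-nonNeg ∣ b - a ∣ {{nonNegative (0≤∣p∣ (b - a))}}
        (*-mono-≤-nonNeg {1/a} {1/δ} {1/b} {1/δ}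
          (<⇒≤ (1/-pos 0<b)) (<⇒≤ (1/-pos 0<δ))
          (1/₊-antimono 0<δ 0<a δ≤a) (1/₊-antimono 0<δ 0<b δ≤b)))
      (*-monoˡ-<-pos (1/δ * 1/δ)
        {{positive (*-pos 1/δ 1/δ (1/-pos 0<δ) (1/-pos 0<δ))}}
        b-a<))
    where
    1/a 1/b 1/δ : ℚ
    1/a = 1/₊ a 0<a
    1/b = 1/₊ b 0<b
    1/δ = 1/₊ δ 0<δ

    regroup : ∀ e d i → e * (d * d) * (i * i) ≡ e * ((d * i) * (d * i))
    regroup = solve 3 (λ e d i →
      ((e :* (d :* d)) :* (i :* i)) := (e :* ((d :* i) :* (d :* i)))) refl
      where open +-*-Solver

  0<δ⊔ : ∀ {δ} → 0ℚ < δ → ∀ q → 0ℚ < δ ⊔ q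
  0<δ⊔ {δ} 0<δ q = <-≤-trans 0<δ (p≤p⊔q δ q)

  1/-cauchy : ∀ {δ s} (0<δ : 0ℚ < δ) K → (∀ n → K ℕ.≤ n → δ ≤ s n) →
              IsCauchy s → IsCauchy (λ n → 1/₊ (δ ⊔ s n) (0<δ⊔ 0<δ (s n)))
  1/-cauchy {δ} {s} 0<δ K hK cs ε 0<ε =
    combine (cs (ε * (δ * δ)) (*-pos ε (δ * δ) 0<ε (*-pos δ δ 0<δ 0<δ)))
    where
    untruncated : ∀ M k → K ℕ.⊔ M ℕ.≤ k → s k ≡ δ ⊔ s k
    untruncated M k ≤k = sym (p≤q⇒p⊔q≡q (hK k (ℕ.m⊔n≤o⇒m≤o K M ≤k)))

    combine : ∃[ M ] (∀ m n → M ℕ.≤ m → M ℕ.≤ n →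
                ∣ s m - s n ∣ < ε * (δ * δ)) →
              ∃[ N ] (∀ m n → N ℕ.≤ m → N ℕ.≤ n →
                ∣ 1/₊ (δ ⊔ s m) (0<δ⊔ 0<δ (s m))
                - 1/₊ (δ ⊔ s n) (0<δ⊔ 0<δ (s n)) ∣ < ε)
    combine (M , hM) = K ℕ.⊔ M , λ m n ≤m ≤n →
      1/₊-close ε 0<δ (0<δ⊔ 0<δ (s m)) (0<δ⊔ 0<δ (s n))
        (p≤p⊔q δ (s m)) (p≤p⊔q δ (s n))
        (subst (_< ε * (δ * δ))
          (cong₂ (λ p q → ∣ p - q ∣) (untruncated M n ≤n) (untruncated M m ≤m))
          (hM n m (ℕ.m⊔n≤o⇒n≤o K M ≤n) (ℕ.m⊔n≤o⇒n≤o K M ≤m)))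

-- Truncating the terms at the lower bound δ makes every term invertible and
-- changes only finitely many of them.
1/ᵣ : (x : ℝ) → Positiveᵣ x → ℝ
1/ᵣ (mkℝ s cs) (δ , 0<δ , K , hK) =
  mkℝ (λ n → (1/ (δ ⊔ s n)) {{>-nonZero (0<δ⊔ 0<δ (s n))}})
      (1/-cauchy {δ} {s} 0<δ K hK cs)

2^_ : ℤ → ℚ
2^ (+ n)      = + (2 ℕ.^ n) / 1
2^ (-[1+ n ]) = (+ 1 / (2 ℕ.^ suc n)) {{ℕ.m^n≢0 2 (suc n)}}

-- y is the binary logarithm of x > 0.  A real y is determined by the rationals
-- a / b on either side of it, and 2 ^ (a / b) < x means 2 ^ a < x ^ b.
IsLog₂ : ℝ → ℝ → Set
IsLog₂ x y = ∀ (a : ℤ) (b : ℕ) .{{_ : ℕ.NonZero b}} →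
  (fromℚ (a / b) <ᵣ y → fromℚ (2^ a) <ᵣ x ^ᵣ b) ×
  (y <ᵣ fromℚ (a / b) → x ^ᵣ b <ᵣ fromℚ (2^ a))

-- m = ⌈ x ⌉.  A relation, because the ceiling of a Cauchy real is not
-- computable.
IsCeiling : ℝ → ℕ → Set
IsCeiling x m = x ≤ᵣ fromℕ m × fromℕ m <ᵣ x +ᵣ 1ℝ

------------------------------------------------------------------------
-- Layer-ordered heaps

-- ∑ j ≤ i , α ^ j
geometricSum : ℝ → ℕ → ℝ
geometricSum α zero    = α ^ᵣ zero
geometricSum α (suc i) = geometricSum α i +ᵣ α ^ᵣ suc i

IsPivots : ℝ → (ℕ → ℕ) → Set
IsPivots α p = ∀ i → IsCeiling (geometricSum α i) (p i)

-- Position k lies in layer i.  Positions range over Fin n, so the layer after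
-- the last pivot that is at most n consists of what is left of the array.
InLayer : (ℕ → ℕ) → ℕ → ℕ → Set
InLayer p zero    k = k ℕ.< p 0
InLayer p (suc i) k = p i ℕ.≤ k × k ℕ.< p (suc i)

-- Comparisons see only the relative order of the values, so arrays of distinct
-- natural numbers represent all arrays of distinct comparable values.
record Array (n : ℕ) : Set where
  constructor mkArray
  field
    value    : Fin n → ℕ
    distinct : Injective _≡_ _≡_ value

open Array public

IsLOH : ∀ {n} → (ℕ → ℕ) → (Fin n → ℕ) → Set
IsLOH {n} p b = ∀ i (k l : Fin n) →
  InLayer p i (toℕ k) → InLayer p (suc i) (toℕ l) → b k ℕ.≤ b l

------------------------------------------------------------------------
-- Comparison-based algorithms

-- compare i j s t asks whether the value at position i is at most the one at
-- position j, and goes on with s if so and with t if not.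
data DecisionTree (n : ℕ) : Set where
  output  : Permutation′ n → DecisionTree n
  compare : Fin n → Fin n → DecisionTree n → DecisionTree n → DecisionTree n

result : ∀ {n} → DecisionTree n → Array n → Permutation′ n
result (output π)        a = π
result (compare i j s t) a =
  if does (value a i ℕ.≤? value a j) then result s a else result t a

comparisons : ∀ {n} → DecisionTree n → Array n → ℕ
comparisons (output π)        a = 0
comparisons (compare i j s t) a =
  suc (if does (value a i ℕ.≤? value a j) then comparisons s a
                                          else comparisons t a)

LOHifies : ∀ {n} → (ℕ → ℕ) → DecisionTree n → Set
LOHifies p A = ∀ a → IsLOH p (λ k → value a (result A a ⟨$⟩ʳ k))

IsWorstCase : ∀ {n} → DecisionTree n → ℕ → Set
IsWorstCase A T =
  (∀ a → comparisons A a ℕ.≤ T) × (∃[ a ] comparisons A a ≡ T)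

------------------------------------------------------------------------
-- Lower bounds

-- n log (1 / (α - 1)) + n α log α / (α - 1), where u = log (1 / (α - 1)) and
-- v = log α.  The base of the logarithm only rescales the bound.
bound : (α : ℝ) → 1ℝ <ᵣ α → (u v : ℝ) → ℕ → ℝ
bound α 1<α u v n =
  fromℕ n *ᵣ u +ᵣ (fromℕ n *ᵣ α *ᵣ v) *ᵣ 1/ᵣ (α -ᵣ 1ℝ) 1<α

-- The runtime of LOHification with pivots p is at least C f (n) for all large n.
LOHRuntime≥ : (p : ℕ → ℕ) → ℝ → (ℕ → ℝ) → Set
LOHRuntime≥ p C f = ∃[ N ] ∀ n → N ℕ.≤ n → ∀ (A : DecisionTree n) →
  LOHifies p A → ∀ T → IsWorstCase A T → C *ᵣ f n ≤ᵣ fromℕ T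

{-# OPTIONS --safe #-}

-- With x = α - 1 and y = 1 / x, the bound is n (log (1 + y) + y log (1 + x)).
--
-- Colour every position of the array by the layer in which its value ends up.
-- Any two colourings force different outputs, hence different leaves of the
-- decision tree, so 2 ^ T is at least the number of colourings, which is the
-- product over the layers of the binomial coefficients (q + s) C s, where s is
-- the size of the layer and q the total size of the layers before it.  If
-- s ≤ 2 x q, such a coefficient is at least ((q + s) / s) ^ s ≥ (1 + y / 2) ^ s
-- and also at least (1 + s / q) ^ q ≥ (1 + 2 x) ^ (s y / 2).  Hence, if S is the
-- total size of the layers with s ≤ 2 x q, then both log (1 + y) and
-- y log (1 + x) are at most 2 T / S.  Since s ≤ x q + x + 3, only boundedly many
-- initial layers fail s ≤ 2 x q; these are given a single colour, and 2 S ≥ n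
-- for large n.  Together this gives the constant 1 / 8.
--
-- The inequality for real numbers is refuted at one late index of the Cauchy
-- sequences, where α - 1 = c / d is rational and the counting takes place in ℕ.

module Submission where

module Counting where

  open import Algebra.Properties.CommutativeMonoid.Sum as Sum using (sum-permute)
  open import Data.Bool.Base using (false; if_then_else_; true)
  open import Data.Fin.Base as Fin using (Fin; combine; fromℕ<; toℕ)
  open import Data.Fin.Patterns using (0F; 1F)
  open import Data.Fin.Permutation using (Permutation′; _⟨$⟩ʳ_; _⟨$⟩ˡ_; inverseʳ)
  open import Data.Fin.Properties as Fin
    using (any?; combine-injective; injective⇒≤; toℕ-fromℕ<; toℕ-injective; toℕ<n)
  open import Data.List.Base as List
    using (List; []; _++_; _∷_; concatMap; filter; length; lookup; map; replicate)
  open import Data.List.Membership.Propositional.Properties using (∈-lookup)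
  open import Data.List.Properties as List using (length-++; length-map; length-replicate)
  open import Data.List.Relation.Binary.Disjoint.Propositional using (Disjoint)
  open import Data.List.Relation.Unary.All as All using (All; []; _∷_)
  import Data.List.Relation.Unary.All.Properties as All
  open import Data.List.Relation.Unary.AllPairs as AllPairs using (AllPairs; []; _∷_)
  import Data.List.Relation.Unary.AllPairs.Properties as AllPairs
  open import Data.List.Relation.Unary.Unique.Propositional using (Unique)
  import Data.List.Relation.Unary.Unique.Propositional.Properties as Unique
  open import Data.Nat.Base
  open import Data.Nat.Combinatorics
    using (_C_; k![n∸k]!∣n!; nCk+nC[k+1]≡[n+1]C[k+1]; nCk≡n!/k![n-k]!; nCn≡1)
  open import Data.Nat.DivMod using (m/n*n≡m)
  open import Data.Nat.Properties
  open import Data.Nat.Tactic.RingSolver using (solve-∀)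
  open import Data.Product.Base using (_,_; _×_; proj₁; proj₂; ∃-syntax)
  open import Data.Sum.Base using (inj₁; inj₂)
  open import Defs
    using (Array; DecisionTree; InLayer; IsLOH; LOHifies; compare; comparisons;
           mkArray; output; result; value)
  open import Function.Base using (_∘_)
  open import Relation.Binary.PropositionalEquality
  open import Relation.Nullary.Decidable using (_×-dec_; does; no; yes; ¬?)
  open import Relation.Nullary.Negation using (contradiction)

  -- Power inequalities in ℕ

  ^-distribʳ-* : ∀ k m n → (m * n) ^ k ≡ m ^ k * n ^ k
  ^-distribʳ-* zero    m n = refl
  ^-distribʳ-* (suc k) m n = trans
    (cong (m * n *_) (^-distribʳ-* k m n))
    (swap m n (m ^ k) (n ^ k))
    where
    swap : ∀ a b c d → a * b * (c * d) ≡ a * c * (b * d)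
    swap = solve-∀

  -- The two powers differ by z times a sum of `suc m` products of m factors, each factor being w or
  -- w + z. This is Bernoulli's inequality without subtraction.
  bernoulli : ∀ m w z → (w + z) ^ suc m ≤ w ^ suc m + suc m * z * (w + z) ^ m
  bernoulli zero w z = ≤-reflexive (base w z)
    where
    base : ∀ w z → (w + z) * 1 ≡ w * 1 + (1 * z) * 1
    base = solve-∀
  bernoulli (suc m) w z = begin
    u * u ^ suc m
      ≤⟨ *-monoʳ-≤ u (bernoulli m w z) ⟩
    u * (w ^ suc m + suc m * z * u ^ m)
      ≡⟨ expand w z (w ^ suc m) m (u ^ m) ⟩
    w * w ^ suc m + (z * w ^ suc m + suc m * z * (u * u ^ m))
      ≤⟨ +-monoʳ-≤ (w * w ^ suc m)
           (+-monoˡ-≤ (suc m * z * (u * u ^ m))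
             (*-monoʳ-≤ z (^-monoˡ-≤ (suc m) (m≤m+n w z)))) ⟩
    w * w ^ suc m + (z * u ^ suc m + suc m * z * u ^ suc m)
      ≡⟨ cong (w * w ^ suc m +_) (collect z (u ^ suc m) (suc m)) ⟩
    w * w ^ suc m + suc (suc m) * z * u ^ suc m ∎
    where
    open ≤-Reasoning
    u = w + z

    expand : ∀ w z p m r → (w + z) * (p + suc m * z * r) ≡
                           w * p + (z * p + suc m * z * ((w + z) * r))
    expand = solve-∀

    collect : ∀ z r m → z * r + m * z * r ≡ suc m * z * r
    collect = solve-∀

  -- One step of the growth of (1 + z / k) ^ k, with denominators cleared. The products u = (k + z)
  -- (k + 1) and w = (k + 1 + z) k differ by exactly z. Since u = (k + 1) k + (k + 1) z, `bernoulli`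
  -- leaves (k + 1) k u ^ k ≤ w ^ (k + 1), from which a factor k is cancelled.
  [1+z/k]^k-step : ∀ z k →
    (k + z) ^ k * suc k ^ suc k ≤ (suc k + z) ^ suc k * k ^ k
  [1+z/k]^k-step z zero = s≤s z≤n
  [1+z/k]^k-step z k@(suc _) = *-cancelˡ-≤ k (begin
    k * (v ^ k * (suc k * suc k ^ k))
      ≡⟨ rearrange k (v ^ k) (suc k ^ k) ⟩
    suc k * k * (v ^ k * suc k ^ k)
      ≡⟨ cong (suc k * k *_) (sym (^-distribʳ-* k v (suc k))) ⟩
    suc k * k * u ^ k
      ≤⟨ +-cancelʳ-≤ (suc k * z * u ^ k) _ _ (begin
           suc k * k * u ^ k + suc k * z * u ^ k ≡⟨ split k z (u ^ k) ⟩
           u * u ^ k                             ≡⟨ cong (_^ suc k) (u≡ k z) ⟩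
           (w + z) ^ suc k                       ≤⟨ bernoulli k w z ⟩
           w ^ suc k + suc k * z * (w + z) ^ k
             ≡⟨ cong (λ x → w ^ suc k + suc k * z * x ^ k) (sym (u≡ k z)) ⟩
           w ^ suc k + suc k * z * u ^ k         ∎) ⟩
    w ^ suc k
      ≡⟨ ^-distribʳ-* (suc k) (suc k + z) k ⟩
    (suc k + z) ^ suc k * (k * k ^ k)
      ≡⟨ pull ((suc k + z) ^ suc k) k (k ^ k) ⟩
    k * ((suc k + z) ^ suc k * k ^ k) ∎)
    where
    open ≤-Reasoning
    v = k + z
    u = v * suc k
    w = (suc k + z) * k

    rearrange : ∀ k p q → k * (p * (suc k * q)) ≡ suc k * k * (p * q)
    rearrange = solve-∀

    split : ∀ k z p → suc k * k * p + suc k * z * p ≡ (k + z) * suc k * p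
    split = solve-∀

    u≡ : ∀ k z → (k + z) * suc k ≡ (suc k + z) * k + z
    u≡ = solve-∀

    pull : ∀ p k q → p * (k * q) ≡ k * (p * q)
    pull = solve-∀

  n^n≢0 : ∀ n → NonZero (n ^ n)
  n^n≢0 zero      = _
  n^n≢0 n@(suc _) = m^n≢0 n n

  -- (1 + z / k) ^ k increases with k.
  [1+z/k]^k-mono : ∀ z {l k} → l ≤′ k →
    (l + z) ^ l * k ^ k ≤ (k + z) ^ k * l ^ l
  [1+z/k]^k-mono z ≤′-refl = ≤-refl
  [1+z/k]^k-mono z {l} {suc k} (≤′-step l≤k) =
    *-cancelʳ-≤ _ _ (k ^ k) {{n^n≢0 k}} (begin
    (l + z) ^ l * suc k ^ suc k * k ^ k
      ≡⟨ swap ((l + z) ^ l) (suc k ^ suc k) (k ^ k) ⟩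
    (l + z) ^ l * k ^ k * suc k ^ suc k
      ≤⟨ *-monoˡ-≤ (suc k ^ suc k) ([1+z/k]^k-mono z l≤k) ⟩
    (k + z) ^ k * l ^ l * suc k ^ suc k
      ≡⟨ swap ((k + z) ^ k) (l ^ l) (suc k ^ suc k) ⟩
    (k + z) ^ k * suc k ^ suc k * l ^ l
      ≤⟨ *-monoˡ-≤ (l ^ l) ([1+z/k]^k-step z k) ⟩
    (suc k + z) ^ suc k * k ^ k * l ^ l
      ≡⟨ swap ((suc k + z) ^ suc k) (k ^ k) (l ^ l) ⟩
    (suc k + z) ^ suc k * l ^ l * k ^ k ∎)
    where
    open ≤-Reasoning
    swap : ∀ a b c → a * b * c ≡ a * c * b
    swap = solve-∀

  -- Lower bounds for binomial coefficients

  [q+s]Cs*q!s!≡[q+s]! : ∀ q s → ((q + s) C s) * (s ! * q !) ≡ (q + s) !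
  [q+s]Cs*q!s!≡[q+s]! q s = trans
    (cong (λ r → ((q + s) C s) * (s ! * r !)) (sym (m+n∸n≡m q s)))
    (trans
      (cong (_* (s ! * (q + s ∸ s) !)) (nCk≡n!/k![n-k]! (m≤n+m s q)))
      (m/n*n≡m (k![n∸k]!∣n! (m≤n+m s q))))
    where instance _ = s !* (q + s ∸ s) !≢0

  -- The quotient (q + s)! / (q! s!) is the product of the (q + i) / i.
  ratio^s≤binomial : ∀ a b q s → (∀ i → i ≤ s → b * i ≤ a * (q + i)) →
    b ^ s * (s ! * q !) ≤ a ^ s * (q + s) !
  ratio^s≤binomial a b q zero    h = ≤-reflexive
    (trans (+-identityʳ _) (cong (λ r → r ! + 0) (sym (+-identityʳ q))))
  ratio^s≤binomial a b q (suc s) h = begin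
    b * b ^ s * (suc s * s ! * q !)
      ≡⟨ regroup b (b ^ s) (suc s) (s !) (q !) ⟩
    b * suc s * (b ^ s * (s ! * q !))
      ≤⟨ *-mono-≤ (h (suc s) ≤-refl)
           (ratio^s≤binomial a b q s (λ i i≤s → h i (m≤n⇒m≤1+n i≤s))) ⟩
    a * (q + suc s) * (a ^ s * (q + s) !)
      ≡⟨ swap a (q + suc s) (a ^ s) ((q + s) !) ⟩
    a * a ^ s * ((q + suc s) * (q + s) !)
      ≡⟨ cong (λ r → a * a ^ s * (r * (q + s) !)) (+-suc q s) ⟩
    a * a ^ s * suc (q + s) !
      ≡⟨ cong (λ r → a * a ^ s * r !) (sym (+-suc q s)) ⟩
    a * a ^ s * (q + suc s) ! ∎
    where
    open ≤-Reasoning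
    regroup : ∀ a b c d e → a * b * (c * d * e) ≡ a * c * (b * (d * e))
    regroup = solve-∀
    swap : ∀ a b c d → a * b * (c * d) ≡ a * c * (b * d)
    swap = solve-∀

  -- In both binomial bounds d s ≤ 2 c q stands for s / q ≤ 2 (α - 1), with
  -- α - 1 = c / d.
  binomial-boundˢ : ∀ c d q s → d * s ≤ 2 * c * q →
    (2 * c + d) ^ s ≤ (2 * c) ^ s * ((q + s) C s)
  binomial-boundˢ c d q s ds≤2cq = *-cancelʳ-≤ _ _ (s ! * q !) {{s !* q !≢0}} (begin
    (2 * c + d) ^ s * (s ! * q !)
      -- For i ≤ s the factor 1 + q / i is at least 1 + d / (2 c), because d i ≤ d s ≤ 2 c q.
      ≤⟨ ratio^s≤binomial (2 * c) (2 * c + d) q s (λ i i≤s → begin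
           (2 * c + d) * i             ≡⟨ *-distribʳ-+ i (2 * c) d ⟩
           2 * c * i + d * i           ≤⟨ +-monoʳ-≤ (2 * c * i) (≤-trans (*-monoʳ-≤ d i≤s) ds≤2cq) ⟩
           2 * c * i + 2 * c * q       ≡⟨ +-comm (2 * c * i) (2 * c * q) ⟩
           2 * c * q + 2 * c * i       ≡⟨ *-distribˡ-+ (2 * c) q i ⟨
           2 * c * (q + i)             ∎) ⟩
    (2 * c) ^ s * (q + s) !
      ≡⟨ cong ((2 * c) ^ s *_) ([q+s]Cs*q!s!≡[q+s]! q s) ⟨
    (2 * c) ^ s * (((q + s) C s) * (s ! * q !))
      ≡⟨ *-assoc ((2 * c) ^ s) _ _ ⟨
    (2 * c) ^ s * ((q + s) C s) * (s ! * q !) ∎)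
    where open ≤-Reasoning

  -- The roles of q and s are exchanged: the coefficient is also the product of the q factors (s +
  -- i) / i, and each of these is at least (s + q) / q.
  [q+s]^q≤q^q*C : ∀ q s → (q + s) ^ q ≤ q ^ q * ((q + s) C s)
  [q+s]^q≤q^q*C q s = *-cancelʳ-≤ _ _ (s ! * q !) {{s !* q !≢0}} (begin
    (q + s) ^ q * (s ! * q !)
      ≡⟨ cong ((q + s) ^ q *_) (*-comm (s !) (q !)) ⟩
    (q + s) ^ q * (q ! * s !)
      ≤⟨ ratio^s≤binomial q (q + s) s q (λ i i≤q → begin
           (q + s) * i     ≡⟨ *-distribʳ-+ i q s ⟩
           q * i + s * i   ≤⟨ +-monoʳ-≤ (q * i) (*-monoʳ-≤ s i≤q) ⟩
           q * i + s * q   ≡⟨ trans (+-comm (q * i) (s * q)) (cong (_+ q * i) (*-comm s q)) ⟩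
           q * s + q * i   ≡⟨ *-distribˡ-+ q s i ⟨
           q * (s + i)     ∎) ⟩
    q ^ q * (s + q) !
      ≡⟨ cong (λ r → q ^ q * r !) (+-comm s q) ⟩
    q ^ q * (q + s) !
      ≡⟨ cong (q ^ q *_) ([q+s]Cs*q!s!≡[q+s]! q s) ⟨
    q ^ q * (((q + s) C s) * (s ! * q !))
      ≡⟨ *-assoc (q ^ q) _ _ ⟨
    q ^ q * ((q + s) C s) * (s ! * q !) ∎)
    where open ≤-Reasoning

  -- Raising `[q+s]^q≤q^q*C` to the power 2 c gives (1 + s / q) ^ K = (1 + Z / K) ^ K with K = 2 c q
  -- and Z = 2 c s. By monotonicity K may be lowered to L = d s, and (1 + Z / L) ^ L is (1 + 2 c /
  -- d) ^ (d s).
  binomial-boundᵠ : ∀ c d q s .{{_ : NonZero c}} → d * s ≤ 2 * c * q →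
    (2 * c + d) ^ (d * s) ≤ d ^ (d * s) * ((q + s) C s) ^ (2 * c)
  binomial-boundᵠ c d q zero    h rewrite *-zeroʳ d =
    ≤-reflexive (sym (trans (+-identityʳ _) (^-zeroˡ (2 * c))))
  binomial-boundᵠ c d q s@(suc _) h =
    *-cancelʳ-≤ _ _ (K ^ K * s ^ L) {{m*n≢0 _ _ {{n^n≢0 K}} {{m^n≢0 s L}}}} (begin
    (2 * c + d) ^ L * (K ^ K * s ^ L)
      ≡⟨ assocˡ ((2 * c + d) ^ L) (K ^ K) (s ^ L) ⟩
    (2 * c + d) ^ L * s ^ L * K ^ K
      ≡⟨ cong (_* K ^ K) (^-distribʳ-* L (2 * c + d) s) ⟨
    ((2 * c + d) * s) ^ L * K ^ K
      ≡⟨ cong (λ r → r ^ L * K ^ K) (trans (*-distribʳ-+ s (2 * c) d) (+-comm (2 * c * s) L)) ⟩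
    (L + Z) ^ L * K ^ K
      ≤⟨ [1+z/k]^k-mono Z (≤⇒≤′ h) ⟩
    (K + Z) ^ K * L ^ L
      ≡⟨ cong (λ r → r ^ K * L ^ L) (*-distribˡ-+ (2 * c) q s) ⟨
    (2 * c * (q + s)) ^ K * L ^ L
      ≡⟨ cong₂ _*_ (^-distribʳ-* K (2 * c) (q + s)) (^-distribʳ-* L d s) ⟩
    (2 * c) ^ K * (q + s) ^ K * (d ^ L * s ^ L)
      ≤⟨ *-monoˡ-≤ (d ^ L * s ^ L) (*-monoʳ-≤ ((2 * c) ^ K) (begin
           (q + s) ^ K
             ≡⟨ trans (cong ((q + s) ^_) (*-comm (2 * c) q)) (sym (^-*-assoc (q + s) q (2 * c))) ⟩
           ((q + s) ^ q) ^ (2 * c)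
             ≤⟨ ^-monoˡ-≤ (2 * c) ([q+s]^q≤q^q*C q s) ⟩
           (q ^ q * B) ^ (2 * c)
             ≡⟨ ^-distribʳ-* (2 * c) (q ^ q) B ⟩
           (q ^ q) ^ (2 * c) * B ^ (2 * c)
             ≡⟨ cong (_* B ^ (2 * c))
                 (trans (^-*-assoc q q (2 * c)) (cong (q ^_) (*-comm q (2 * c)))) ⟩
           q ^ K * B ^ (2 * c) ∎)) ⟩
    (2 * c) ^ K * (q ^ K * B ^ (2 * c)) * (d ^ L * s ^ L)
      ≡⟨ collect ((2 * c) ^ K) (q ^ K) (B ^ (2 * c)) (d ^ L) (s ^ L) ⟩
    d ^ L * B ^ (2 * c) * ((2 * c) ^ K * q ^ K * s ^ L)
      ≡⟨ cong (λ r → d ^ L * B ^ (2 * c) * (r * s ^ L)) (^-distribʳ-* K (2 * c) q) ⟨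
    d ^ L * B ^ (2 * c) * (K ^ K * s ^ L) ∎)
    where
    open ≤-Reasoning
    B = ((q + s) C s)
    K = 2 * c * q
    L = d * s
    Z = 2 * c * s

    assocˡ : ∀ a b c → a * (b * c) ≡ a * c * b
    assocˡ = solve-∀
    collect : ∀ a b c d e → a * (b * c) * (d * e) ≡ d * c * (a * b * e)
    collect = solve-∀

  -- Leaves of a decision tree

  open Sum +-0-commutativeMonoid using (sum)

  -- The path as T bits, so that leaves of all depths share one finite type. The value at a
  -- `compare` with no bits left is a filler, out of reach for inputs with at most T comparisons.
  leaf : ∀ {n} → DecisionTree n → ∀ T → Array n → Fin (2 ^ T)
  leaf (output π)        T       a = fromℕ< (m^n>0 2 T)
  leaf (compare i j s t) zero    a = 0F
  leaf (compare i j s t) (suc T) a =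
    if does (value a i ≤? value a j) then combine {2} 0F (leaf s T a)
                                     else combine {2} 1F (leaf t T a)

  -- Equal codes have equal leading bits, so both runs take the same branch at every comparison.
  same-leaf⇒same-result : ∀ {n} (A : DecisionTree n) T a b →
    comparisons A a ≤ T → comparisons A b ≤ T →
    leaf A T a ≡ leaf A T b → result A a ≡ result A b
  same-leaf⇒same-result (output π) T a b _ _ _ = refl
  same-leaf⇒same-result (compare i j s t) (suc T) a b (s≤s ca) (s≤s cb) eq
    with does (value a i ≤? value a j) | does (value b i ≤? value b j)
  ... | true  | true  = same-leaf⇒same-result s T a b ca cb
    (proj₂ (combine-injective {2} 0F (leaf s T a) 0F (leaf s T b) eq))
  ... | false | false = same-leaf⇒same-result t T a b ca cb
    (proj₂ (combine-injective {2} 1F (leaf t T a) 1F (leaf t T b) eq))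
  ... | true  | false =
    contradiction (proj₁ (combine-injective {2} 0F (leaf s T a) 1F (leaf t T b) eq)) λ ()
  ... | false | true  =
    contradiction (proj₁ (combine-injective {2} 1F (leaf t T a) 0F (leaf s T b) eq)) λ ()

  -- Inserting the copies of a new colour into a word

  insertions : ℕ → ℕ → List ℕ → List (List ℕ)
  insertions c zero    w       = w ∷ []
  insertions c (suc s) []      = map (c ∷_) (insertions c s [])
  insertions c (suc s) (x ∷ w) =
    map (x ∷_) (insertions c (suc s) w) ++ map (c ∷_) (insertions c s (x ∷ w))

  -- Either the old letter or the new colour comes first; these two alternatives are the two terms
  -- of Pascal's rule.
  length-insertions : ∀ c s w → length (insertions c s w) ≡ (length w + s) C s
  length-insertions c zero    w       = refl
  length-insertions c (suc s) []      = trans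
    (length-map (c ∷_) (insertions c s []))
    (trans (length-insertions c s []) (trans (nCn≡1 s) (sym (nCn≡1 (suc s)))))
  length-insertions c (suc s) (x ∷ w) = begin
    length (map (x ∷_) (insertions c (suc s) w) ++ map (c ∷_) (insertions c s (x ∷ w)))
      ≡⟨ length-++ (map (x ∷_) (insertions c (suc s) w)) ⟩
    length (map (x ∷_) (insertions c (suc s) w)) + length (map (c ∷_) (insertions c s (x ∷ w)))
      ≡⟨ cong₂ _+_ (length-map (x ∷_) (insertions c (suc s) w))
                   (length-map (c ∷_) (insertions c s (x ∷ w))) ⟩
    length (insertions c (suc s) w) + length (insertions c s (x ∷ w))
      ≡⟨ cong₂ _+_ (length-insertions c (suc s) w) (length-insertions c s (x ∷ w)) ⟩
    (length w + suc s) C suc s + suc (length w + s) C s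
      ≡⟨ cong (λ r → (length w + suc s) C suc s + r C s) (+-suc (length w) s) ⟨
    (length w + suc s) C suc s + (length w + suc s) C s
      ≡⟨ +-comm ((length w + suc s) C suc s) _ ⟩
    (length w + suc s) C s + (length w + suc s) C suc s
      ≡⟨ nCk+nC[k+1]≡[n+1]C[k+1] (length w + suc s) s ⟩
    suc (length w + suc s) C suc s ∎
    where open ≡-Reasoning

  -- Describes the members of `insertions` by derivations, so that their properties follow by
  -- induction without reference to the list.
  data Inserted (c : ℕ) : ℕ → List ℕ → List ℕ → Set where
    none : Inserted c 0 [] []
    keep : ∀ {s x w v} → Inserted c s w v → Inserted c s (x ∷ w) (x ∷ v)
    new  : ∀ {s w v} → Inserted c s w v → Inserted c (suc s) w (c ∷ v)

  inserted-refl : ∀ c w → Inserted c 0 w w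
  inserted-refl c []      = none
  inserted-refl c (x ∷ w) = keep (inserted-refl c w)

  insertions-inserted : ∀ c s w → All (Inserted c s w) (insertions c s w)
  insertions-inserted c zero    w       = inserted-refl c w ∷ []
  insertions-inserted c (suc s) []      =
    All.map⁺ (All.map new (insertions-inserted c s []))
  insertions-inserted c (suc s) (x ∷ w) = All.++⁺
    (All.map⁺ (All.map keep (insertions-inserted c (suc s) w)))
    (All.map⁺ (All.map new (insertions-inserted c s (x ∷ w))))

  remove : ℕ → List ℕ → List ℕ
  remove c = filter (λ x → ¬? (x ≟ c))

  -- The old word can be recovered from the new one, which later makes the insertions into different
  -- words disjoint.
  remove-inserted : ∀ {c s w v} → All (_≢ c) w → Inserted c s w v → remove c v ≡ w
  remove-inserted []         none    = refl
  remove-inserted {c} (x≢c ∷ w≢c) (keep {x = x} i) = trans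
    (List.filter-accept (λ x → ¬? (x ≟ c)) x≢c)
    (cong (x ∷_) (remove-inserted w≢c i))
  remove-inserted {c} w≢c         (new i)  = trans
    (List.filter-reject (λ x → ¬? (x ≟ c)) (λ c≢c → c≢c refl))
    (remove-inserted w≢c i)

  inserted-length : ∀ {c s w v} → Inserted c s w v → length v ≡ length w + s
  inserted-length none                     = refl
  inserted-length (keep i)                 = cong suc (inserted-length i)
  inserted-length (new {s = s} {w = w} i)  =
    trans (cong suc (inserted-length i)) (sym (+-suc (length w) s))

  inserted-All : ∀ {P : ℕ → Set} {c s w v} → P c → All P w → Inserted c s w v → All P v
  inserted-All pc []       none     = []
  inserted-All pc (px ∷ pw) (keep i) = px ∷ inserted-All pc pw i
  inserted-All pc pw       (new i)  = pc ∷ inserted-All pc pw i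

  insertions-unique : ∀ c s w → All (_≢ c) w → Unique (insertions c s w)
  insertions-unique c zero    w       _ = [] ∷ []
  insertions-unique c (suc s) []      _ =
    Unique.map⁺ List.∷-injectiveʳ (insertions-unique c s [] [])
  insertions-unique c (suc s) (x ∷ w) (x≢c ∷ w≢c) = Unique.++⁺
    (Unique.map⁺ List.∷-injectiveʳ (insertions-unique c (suc s) w w≢c))
    (Unique.map⁺ List.∷-injectiveʳ (insertions-unique c s (x ∷ w) (x≢c ∷ w≢c)))
    -- A word in both halves would start with x and with c.
    λ (v∈ , v∈′) → x≢c (trans (sym (All.lookup (heads x (insertions c (suc s) w)) v∈))
                              (All.lookup (heads c (insertions c s (x ∷ w))) v∈′))
    where
    head : List ℕ → ℕ
    head []      = 0
    head (y ∷ _) = y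

    heads : ∀ y vs → All (λ v → head v ≡ y) (map (y ∷_) vs)
    heads y vs = All.map⁺ (All.universal (λ _ → refl) vs)

  -- Counting the entries up to a threshold

  𝟙[_≤_] : ℕ → ℕ → ℕ
  𝟙[ m ≤ n ] = if m ≤ᵇ n then 1 else 0

  𝟙-yes : ∀ {m n} → m ≤ n → 𝟙[ m ≤ n ] ≡ 1
  𝟙-yes {m} {n} m≤n with m ≤ᵇ n | ≤⇒≤ᵇ m≤n
  ... | true | _ = refl

  𝟙-no : ∀ {m n} → n < m → 𝟙[ m ≤ n ] ≡ 0
  𝟙-no {m} {n} n<m with m ≤ᵇ n | ≤ᵇ⇒≤ m n
  ... | true  | m≤n = contradiction (m≤n _) (<⇒≱ n<m)
  ... | false | _   = refl

  𝟙≤1 : ∀ m n → 𝟙[ m ≤ n ] ≤ 1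
  𝟙≤1 m n with m ≤ᵇ n
  ... | true  = ≤-refl
  ... | false = z≤n

  𝟙-reflects : ∀ m n → 𝟙[ m ≤ n ] ≡ 1 → m ≤ n
  𝟙-reflects m n eq with m ≤ᵇ n | ≤ᵇ⇒≤ m n
  𝟙-reflects m n eq | true | m≤n = m≤n _

  count≤ : ℕ → List ℕ → ℕ
  count≤ j []      = 0
  count≤ j (x ∷ w) = 𝟙[ x ≤ j ] + count≤ j w

  inserted-count≤ : ∀ {j c s w v} → j < c → Inserted c s w v → count≤ j v ≡ count≤ j w
  inserted-count≤ j<c none                       = refl
  inserted-count≤ {j} j<c (keep {x = x} i)       = cong (𝟙[ x ≤ j ] +_) (inserted-count≤ j<c i)
  inserted-count≤ j<c (new i) rewrite 𝟙-no j<c   = inserted-count≤ j<c i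

  all≤⇒count≤ : ∀ {j w} → All (_≤ j) w → count≤ j w ≡ length w
  all≤⇒count≤ []                            = refl
  all≤⇒count≤ (x≤j ∷ w≤j) rewrite 𝟙-yes x≤j = cong suc (all≤⇒count≤ w≤j)

  -- The default value 0 is never used.
  nth : List ℕ → ℕ → ℕ
  nth []      _       = 0
  nth (x ∷ w) zero    = x
  nth (x ∷ w) (suc i) = nth w i

  nth-All : ∀ {P : ℕ → Set} {w i} → All P w → i < length w → P (nth w i)
  nth-All {i = zero}  (px ∷ _)  _         = px
  nth-All {i = suc i} (_ ∷ pw)  (s≤s i<n) = nth-All pw i<n

  nth-injective : ∀ w w′ → length w ≡ length w′ →
    (∀ (i : Fin (length w)) → nth w (toℕ i) ≡ nth w′ (toℕ i)) → w ≡ w′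
  nth-injective []      []        _  _ = refl
  nth-injective (x ∷ w) (x′ ∷ w′) eq h =
    cong₂ _∷_ (h 0F) (nth-injective w w′ (suc-injective eq) (h ∘ Fin.suc))

  sum-nth : ∀ j w → sum {length w} (λ i → 𝟙[ nth w (toℕ i) ≤ j ]) ≡ count≤ j w
  sum-nth j []      = refl
  sum-nth j (x ∷ w) = cong (𝟙[ x ≤ j ] +_) (sum-nth j w)

  sum-mono-≤ : ∀ {n} {f g : Fin n → ℕ} → (∀ i → f i ≤ g i) → sum f ≤ sum g
  sum-mono-≤ {zero}  f≤g = z≤n
  sum-mono-≤ {suc n} f≤g = +-mono-≤ (f≤g 0F) (sum-mono-≤ (f≤g ∘ Fin.suc))

  -- A summand that fell short could not be made up for by the others.
  sum-≡⇒≗ : ∀ {n} {f g : Fin n → ℕ} → (∀ i → f i ≤ g i) → sum f ≡ sum g → f ≗ g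
  sum-≡⇒≗ {suc n} {f} {g} f≤g eq = λ where
      0F          → head≡
      (Fin.suc i) → sum-≡⇒≗ (f≤g ∘ Fin.suc)
        (+-cancelˡ-≡ (f 0F) _ _ (trans eq (cong (_+ sum (g ∘ Fin.suc)) (sym head≡)))) i
    where
    head≡ : f 0F ≡ g 0F
    head≡ = ≤-antisym (f≤g 0F) (+-cancelʳ-≤ (sum (g ∘ Fin.suc)) _ _
      (≤-trans (≤-reflexive (sym eq)) (+-monoʳ-≤ (f 0F) (sum-mono-≤ (f≤g ∘ Fin.suc)))))

  sum-initial : ∀ {n} q → q ≤ n → sum {n} (λ k → 𝟙[ suc (toℕ k) ≤ q ]) ≡ q
  sum-initial {zero}  zero    _         = refl
  sum-initial {suc n} zero    _         = sum-initial {n} zero z≤n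
  sum-initial {suc n} (suc q) (s≤s q≤n) = cong suc (sum-initial q q≤n)

  -- Otherwise the elements of colour at most j would be a proper subset or a
  -- proper superset of the first q ones.
  threshold⇒initial : ∀ {n} (F : Fin n → ℕ) j q → q ≤ n →
    (∀ k l → toℕ k < q → q ≤ toℕ l → F k ≤ F l) →
    sum (λ k → 𝟙[ F k ≤ j ]) ≡ q →
    ∀ k → 𝟙[ F k ≤ j ] ≡ 𝟙[ suc (toℕ k) ≤ q ]
  threshold⇒initial F j q q≤n mono sum≡q
    with any? (λ k → (toℕ k <? q) ×-dec (j <? F k))
  ... | yes (k₀ , k₀<q , j<Fk₀) = sum-≡⇒≗ fewer (trans sum≡q (sym (sum-initial q q≤n)))
    where
    fewer : ∀ k → 𝟙[ F k ≤ j ] ≤ 𝟙[ suc (toℕ k) ≤ q ]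
    fewer k with <-≤-connex (toℕ k) q
    ... | inj₁ k<q = ≤-trans (𝟙≤1 (F k) j) (≤-reflexive (sym (𝟙-yes k<q)))
    ... | inj₂ q≤k = ≤-trans (≤-reflexive (𝟙-no (<-≤-trans j<Fk₀ (mono k₀ k k₀<q q≤k)))) z≤n
  ... | no ¬∃ = λ k → sym (sum-≡⇒≗ more (trans (sum-initial q q≤n) (sym sum≡q)) k)
    where
    more : ∀ k → 𝟙[ suc (toℕ k) ≤ q ] ≤ 𝟙[ F k ≤ j ]
    more k with <-≤-connex (toℕ k) q | <-≤-connex j (F k)
    ... | inj₁ k<q | inj₁ j<Fk = contradiction (k , k<q , j<Fk) ¬∃
    ... | inj₁ k<q | inj₂ Fk≤j = ≤-trans (𝟙≤1 (suc (toℕ k)) q) (≤-reflexive (sym (𝟙-yes Fk≤j)))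
    ... | inj₂ q≤k | _         = ≤-trans (≤-reflexive (𝟙-no (s≤s q≤k))) z≤n

  AllPairs-upgrade : ∀ {A : Set} {P : A → Set} {R S : A → A → Set} {xs} →
    (∀ {x y} → P x → P y → R x y → S x y) → All P xs → AllPairs R xs → AllPairs S xs
  AllPairs-upgrade f []         []         = []
  AllPairs-upgrade f (px ∷ pxs) (rx ∷ rxs) =
    All.zipWith (λ (py , r) → f px py r) (pxs , rx) ∷ AllPairs-upgrade f pxs rxs

  lookup-injective : ∀ {A : Set} {xs : List A} → Unique xs → ∀ i j →
    lookup xs i ≡ lookup xs j → i ≡ j
  lookup-injective (_ ∷ _)   0F          0F          _  = refl
  lookup-injective (x∉ ∷ _)  0F          (Fin.suc j) eq = contradiction eq
      (All.lookup x∉ (∈-lookup j))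
  lookup-injective (x∉ ∷ _)  (Fin.suc i) 0F          eq = contradiction (sym eq)
      (All.lookup x∉ (∈-lookup i))
  lookup-injective (_ ∷ xs!) (Fin.suc i) (Fin.suc j) eq = cong Fin.suc (lookup-injective xs! i j eq)

  -- Colourings with given cumulative counts

  module Colourings (q : ℕ → ℕ) (q-mono : ∀ k → q k ≤ q (suc k)) where

    -- Adding one colour at a time makes the number of colourings a product of binomial
    -- coefficients. Here q k is the number of positions of colour at most k.
    colourings : ℕ → List (List ℕ)
    colourings zero    = replicate (q 0) 0 ∷ []
    colourings (suc k) =
      concatMap (insertions (suc k) (q (suc k) ∸ q k)) (colourings k)

    -- The counts are cumulative because `threshold⇒initial` consumes them in this form.
    record Valid (k : ℕ) (w : List ℕ) : Set where
      field
        length≡ : length w ≡ q k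
        all≤    : All (_≤ k) w
        counts  : ∀ j → j ≤ k → count≤ j w ≡ q j

    open Valid public

    inserted-valid : ∀ {k w v} → Valid k w →
      Inserted (suc k) (q (suc k) ∸ q k) w v → Valid (suc k) v
    inserted-valid {k} {w} {v} ok i = λ where
        .length≡ → length-v
        .all≤    → v≤
        .counts j j≤ → counts-v j (m≤n⇒m<n∨m≡n j≤)
      where
      length-v : length v ≡ q (suc k)
      length-v = trans (inserted-length i)
        (trans (cong (_+ _) (length≡ ok)) (m+[n∸m]≡n (q-mono k)))

      v≤ : All (_≤ suc k) v
      v≤ = inserted-All ≤-refl (All.map m≤n⇒m≤1+n (all≤ ok)) i

      counts-v : ∀ j → _ → count≤ j v ≡ q j
      counts-v j (inj₁ (s≤s j≤k)) = trans (inserted-count≤ (s≤s j≤k) i) (counts ok j j≤k)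
      counts-v j (inj₂ refl)      = trans (all≤⇒count≤ v≤) length-v

    colourings-valid : ∀ k → All (Valid k) (colourings k)
    colourings-valid zero = base ∷ []
      where
      base≤ : All (_≤ 0) (replicate (q 0) 0)
      base≤ = All.replicate⁺ (q 0) z≤n

      base : Valid 0 (replicate (q 0) 0)
      base .length≡         = length-replicate (q 0)
      base .all≤            = base≤
      base .counts zero z≤n = trans (all≤⇒count≤ base≤) (length-replicate (q 0))
    colourings-valid (suc k) = All.concat⁺ (All.map⁺ (All.map
      (λ {w} ok → All.map (inserted-valid ok) (insertions-inserted (suc k) _ w))
      (colourings-valid k)))

    colourings-unique : ∀ k → Unique (colourings k)
    colourings-unique zero    = [] ∷ []
    colourings-unique (suc k) = Unique.concat⁺
      (All.map⁺ (All.map (λ {w} ok → insertions-unique (suc k) (q (suc k) ∸ q k) w (fresh ok))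
          (colourings-valid k)))
      (AllPairs.map⁺ (AllPairs-upgrade disjoint (colourings-valid k) (colourings-unique k)))
      where
      fresh : ∀ {w} → Valid k w → All (_≢ suc k) w
      fresh ok = All.map (λ x≤k → <⇒≢ (s≤s x≤k)) (all≤ ok)

      disjoint : ∀ {w w′} → Valid k w → Valid k w′ → w ≢ w′ →
        Disjoint (insertions (suc k) (q (suc k) ∸ q k) w) (insertions (suc k) (q (suc k) ∸ q k) w′)
      disjoint {w} {w′} ok ok′ w≢w′ (v∈ , v∈′) = w≢w′ (trans
        (sym (remove-inserted (fresh ok)
            (All.lookup (insertions-inserted (suc k) (q (suc k) ∸ q k) w) v∈)))
        (remove-inserted (fresh ok′)
            (All.lookup (insertions-inserted (suc k) (q (suc k) ∸ q k) w′) v∈′)))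

    length-colourings : ∀ k → length (colourings (suc k)) ≡
      length (colourings k) * ((q k + (q (suc k) ∸ q k)) C (q (suc k) ∸ q k))
    length-colourings k = go (colourings k) (colourings-valid k)
      where
      s = q (suc k) ∸ q k

      go : ∀ ws → All (Valid k) ws →
        length (concatMap (insertions (suc k) s) ws) ≡ length ws * ((q k + s) C s)
      go []       []         = refl
      go (w ∷ ws) (ok ∷ oks) = trans (length-++ (insertions (suc k) s w))
        (cong₂ _+_ (trans (length-insertions (suc k) s w) (cong (λ r → (r + s) C s) (length≡ ok)))
                   (go ws oks))

  -- From colourings to arrays

  -- The colour is the leading digit in base n and the position the last one. Values are therefore
  -- distinct, and their order refines that of the colours.
  array-value : ∀ {n} → List ℕ → Fin n → ℕ
  array-value {n} w i = nth w (toℕ i) * n + toℕ i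

  array-value-≤ : ∀ {n} w (i j : Fin n) →
    array-value w i ≤ array-value w j → nth w (toℕ i) ≤ nth w (toℕ j)
  array-value-≤ {n} w i j vi≤vj = ≮⇒≥ λ cj<ci → <⇒≱ (begin-strict
    nth w (toℕ j) * n + toℕ j <⟨ +-monoʳ-< _ (toℕ<n j) ⟩
    nth w (toℕ j) * n + n     ≡⟨ +-comm (nth w (toℕ j) * n) n ⟩
    suc (nth w (toℕ j)) * n   ≤⟨ *-monoˡ-≤ n cj<ci ⟩
    nth w (toℕ i) * n         ≤⟨ m≤m+n _ (toℕ i) ⟩
    nth w (toℕ i) * n + toℕ i ∎) vi≤vj
    where open ≤-Reasoning

  array : ∀ {n} → List ℕ → Array n
  array {n} w = mkArray (array-value w) λ {i} {j} eq →
    toℕ-injective (+-cancelˡ-≡ (nth w (toℕ i) * n) _ _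
      (trans eq (cong (λ c → c * n + toℕ j) (≤-antisym
        (array-value-≤ w j i (≤-reflexive (sym eq)))
        (array-value-≤ w i j (≤-reflexive eq))))))

  -- Different colourings reach different leaves

  module _ (p : ℕ → ℕ) (p-< : ∀ i → p i < p (suc i)) where

    i≤pᵢ : ∀ i → i ≤ p i
    i≤pᵢ zero    = z≤n
    i≤pᵢ (suc i) = ≤-<-trans (i≤pᵢ i) (p-< i)

    p-mono : ∀ {i j} → i ≤′ j → p i ≤ p j
    p-mono ≤′-refl       = ≤-refl
    p-mono (≤′-step i≤j) = ≤-trans (p-mono i≤j) (<⇒≤ (p-< _))

    layer-below : ∀ i {k} → k < p i → ∃[ i′ ] i′ ≤ i × InLayer p i′ k
    layer-below zero    k<p = 0 , z≤n , k<p
    layer-below (suc i) {k} k<p with <-≤-connex k (p i)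
    ... | inj₂ p≤k = suc i , ≤-refl , p≤k , k<p
    ... | inj₁ k<pᵢ with i′ , i′≤i , k∈ ← layer-below i k<pᵢ = i′ , m≤n⇒m≤1+n i′≤i , k∈

    layer-above : ∀ i {k} → p i ≤ k → ∃[ i′ ] i < i′ × InLayer p i′ k
    layer-above i {k} p≤k with layer-below (suc k) (i≤pᵢ (suc k))
    ... | i′ , _ , k∈ = i′ , ≰⇒>
        (λ i′≤i → <⇒≱ (<-≤-trans (upper i′ k∈) (p-mono (≤⇒≤′ i′≤i))) p≤k) , k∈
      where
      upper : ∀ i′ → InLayer p i′ k → k < p i′
      upper zero     k<p       = k<p
      upper (suc i′) (_ , k<p) = k<p

    -- `IsLOH` relates adjacent layers only, so the inequality is chained through the first position
    -- `p i′` of the layer just before that of l. This position exists in the array because l lies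
    -- further right.
    loh-layers : ∀ {n} {b : Fin n → ℕ} → IsLOH p b → ∀ {i i′} → i <′ i′ → ∀ k l →
      InLayer p i (toℕ k) → InLayer p i′ (toℕ l) → b k ≤ b l
    loh-layers loh {i} <′-base k l k∈ l∈ = loh i k l k∈ l∈
    loh-layers loh {i} {suc zero} (<′-step i<0) k l _ _ = contradiction (≤′⇒≤ i<0) λ ()
    loh-layers {n} loh {i} {suc (suc i′)} (<′-step i<i′) k l k∈ l∈@(p≤l , _) =
      ≤-trans (loh-layers loh i<i′ k m k∈ m∈) (loh (suc i′) m l m∈ l∈)
      where
      p<n : p i′ < n
      p<n = <-trans (p-< i′) (≤-<-trans p≤l (toℕ<n l))

      m : Fin n
      m = fromℕ< p<n

      m∈ : InLayer p (suc i′) (toℕ m)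
      m∈ rewrite toℕ-fromℕ< p<n = ≤-refl , p-< i′

    loh-threshold : ∀ {n} {b : Fin n → ℕ} → IsLOH p b → ∀ i k l →
      toℕ k < p i → p i ≤ toℕ l → b k ≤ b l
    loh-threshold loh i k l k<p p≤l
      with i₁ , i₁≤i , k∈ ← layer-below i k<p
      with i₂ , i<i₂ , l∈ ← layer-above i p≤l =
      loh-layers loh (<⇒<′ (≤-<-trans i₁≤i i<i₂)) k l k∈ l∈

    module _ {n} (A : DecisionTree n) (lohifies : LOHifies p A) (i₀ : ℕ) where

      -- Layers 0 to i₀ share colour 0, and the cap at n accounts for the end of the array.
      q : ℕ → ℕ
      q j = p (i₀ + j) ⊓ n

      q-mono : ∀ j → q j ≤ q (suc j)
      q-mono j = ⊓-monoˡ-≤ n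
          (≤-trans (<⇒≤ (p-< (i₀ + j))) (≤-reflexive (cong p (sym (+-suc i₀ j)))))

      open Colourings q q-mono

      sorted : List ℕ → Permutation′ n → Fin n → ℕ
      sorted w π k = nth w (toℕ (π ⟨$⟩ʳ k))

      -- The output respects the pivot `p (i₀ + j)`, and a permutation preserves the number of
      -- colours up to j, so `threshold⇒initial` applies. The right side does not mention w: the
      -- sequence of colours in the output is the same for all colourings.
      sorted-threshold : ∀ {k w} → Valid k w → length w ≡ n → ∀ j → j ≤ k → ∀ i →
        𝟙[ sorted w (result A (array w)) i ≤ j ] ≡ 𝟙[ suc (toℕ i) ≤ q j ]
      sorted-threshold {w = w} ok refl j j≤k = threshold⇒initial (sorted w π) j (q j) (m⊓n≤n _ _)
        (λ k l k<q q≤l → array-value-≤ w (π ⟨$⟩ʳ k) (π ⟨$⟩ʳ l)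
          (loh-threshold (lohifies (array w)) (i₀ + j) k l (<-≤-trans k<q (m⊓n≤m _ n)) (p≤ l q≤l)))
        (trans (sym (sum-permute +-0-commutativeMonoid (λ i → 𝟙[ nth w (toℕ i) ≤ j ]) π))
          (trans (sum-nth j w) (counts ok j j≤k)))
        where
        π = result A (array w)

        p≤ : ∀ (l : Fin n) → q j ≤ toℕ l → p (i₀ + j) ≤ toℕ l
        p≤ l q≤l = ≮⇒≥ λ l<p → <⇒≱ (⊓-glb l<p (toℕ<n l)) q≤l

      sorted-≤ : ∀ {k w w′} → Valid k w → Valid k w′ → length w ≡ n → length w′ ≡ n →
        ∀ i → sorted w (result A (array w)) i ≤ sorted w′ (result A (array w′)) i
      sorted-≤ {k} {w} {w′} ok ok′ l≡ l≡′ i = 𝟙-reflects _ j (trans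
        (sorted-threshold ok l≡ j j≤k i)
        (trans (sym (sorted-threshold ok′ l≡′ j j≤k i)) (𝟙-yes {j} ≤-refl)))
        where
        -- The colour of the other word at i, which passes its own threshold.
        j = sorted w′ (result A (array w′)) i

        j≤k : j ≤ k
        j≤k = nth-All (all≤ ok′) (<-≤-trans (toℕ<n _) (≤-reflexive (sym l≡′)))

      -- Both outputs show the same sequence of colours, and undoing the common permutation recovers
      -- both words from it.
      same-result⇒≡ : ∀ {k w w′} → Valid k w → Valid k w′ → q k ≡ n →
        result A (array w) ≡ result A (array w′) → w ≡ w′
      same-result⇒≡ {k} {w} {w′} ok ok′ q≡n eq = nth-injective w w′ (trans l≡ (sym l≡′))
        (subst (λ m → ∀ (i : Fin m) → nth w (toℕ i) ≡ nth w′ (toℕ i)) (sym l≡) nth≡)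
        where
        l≡  = trans (length≡ ok) q≡n
        l≡′ = trans (length≡ ok′) q≡n
        π = result A (array w)

        sorted≡ : ∀ i → sorted w π i ≡ sorted w′ π i
        sorted≡ i = trans
          (≤-antisym (sorted-≤ ok ok′ l≡ l≡′ i) (sorted-≤ ok′ ok l≡′ l≡ i))
          (cong (λ ρ → sorted w′ ρ i) (sym eq))

        nth≡ : ∀ i → nth w (toℕ i) ≡ nth w′ (toℕ i)
        nth≡ i = subst (λ i → nth w (toℕ i) ≡ nth w′ (toℕ i)) (inverseʳ π) (sorted≡ (π ⟨$⟩ˡ i))

      -- Sending a colouring to the leaf reached by its array is injective.
      length-colourings≤2^T : ∀ k T → q k ≡ n → (∀ a → comparisons A a ≤ T) →
        length (colourings k) ≤ 2 ^ T
      length-colourings≤2^T k T q≡n ≤T = injective⇒≤ {f = leaf A T ∘ array ∘ lookup (colourings k)}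
        λ {i} {j} eq → lookup-injective (colourings-unique k) i j
          (same-result⇒≡ (valid i) (valid j) q≡n
            (same-leaf⇒same-result A T (array (lookup (colourings k) i))
                (array (lookup (colourings k) j)) (≤T _) (≤T _) eq))
        where
        valid : ∀ i → Valid k (lookup (colourings k) i)
        valid i = All.lookup (colourings-valid k) (∈-lookup i)

  -- From powers to logarithms

  2^-cancel-≤ : ∀ {m n} → 2 ^ m ≤ 2 ^ n → m ≤ n
  2^-cancel-≤ 2^m≤2^n = ≮⇒≥ λ n<m → <⇒≱ (^-monoʳ-< 2 ≤-refl n<m) 2^m≤2^n

  -- If (1 + y / 2) ^ S ≤ 2 ^ T, where y = d / c, and 2 ^ (a / b) ≤ 1 + y, then
  -- a / b ≤ 2 T / S, because 1 + y ≤ (1 + y / 2) ^ 2.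
  log-boundˢ : ∀ {c d S T} a b .{{_ : NonZero c}} →
    (2 * c + d) ^ S ≤ (2 * c) ^ S * 2 ^ T →
    2 ^ a * c ^ b ≤ (c + d) ^ b → a * S ≤ 2 * T * b
  log-boundˢ {c} {d} {S} {T} a b h 2^a≤ =
    2^-cancel-≤ (*-cancelʳ-≤ _ _ (c ^ (b * S)) {{m^n≢0 c (b * S)}} (begin
    2 ^ (a * S) * c ^ (b * S)
      ≡⟨ cong₂ _*_ (^-*-assoc 2 a S) (^-*-assoc c b S) ⟨
    (2 ^ a) ^ S * (c ^ b) ^ S
      ≡⟨ ^-distribʳ-* S (2 ^ a) (c ^ b) ⟨
    (2 ^ a * c ^ b) ^ S
      ≤⟨ ^-monoˡ-≤ S 2^a≤ ⟩
    ((c + d) ^ b) ^ S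
      ≡⟨ trans (^-*-assoc (c + d) b S)
          (trans (cong ((c + d) ^_) (*-comm b S)) (sym (^-*-assoc (c + d) S b))) ⟩
    ((c + d) ^ S) ^ b
      ≤⟨ ^-monoˡ-≤ b squared ⟩
    (c ^ S * (2 ^ T * 2 ^ T)) ^ b
      ≡⟨ ^-distribʳ-* b (c ^ S) _ ⟩
    (c ^ S) ^ b * (2 ^ T * 2 ^ T) ^ b
      ≡⟨ cong₂ _*_ (trans (^-*-assoc c S b) (cong (c ^_) (*-comm S b)))
                   (trans (cong (_^ b) (trans (sym (^-distribˡ-+-* 2 T T))
                       (cong (λ r → 2 ^ (T + r)) (sym (+-identityʳ T)))))
                          (^-*-assoc 2 (2 * T) b)) ⟩
    c ^ (b * S) * 2 ^ (2 * T * b)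
      ≡⟨ *-comm (c ^ (b * S)) _ ⟩
    2 ^ (2 * T * b) * c ^ (b * S) ∎))
    where
    open ≤-Reasoning

    4c[c+d]≤ : ∀ c d → (c + d) * (4 * c) + d * d ≡ (2 * c + d) * (2 * c + d)
    4c[c+d]≤ = solve-∀

    2c*2c : ∀ c → 2 * c * (2 * c) ≡ c * (4 * c)
    2c*2c = solve-∀

    swap : ∀ a b c d → a * b * (c * d) ≡ a * c * (b * d)
    swap = solve-∀

    swap′ : ∀ a b c → a * b * c ≡ a * c * b
    swap′ = solve-∀

    squared : (c + d) ^ S ≤ c ^ S * (2 ^ T * 2 ^ T)
    squared = *-cancelʳ-≤ _ _ ((4 * c) ^ S) {{m^n≢0 (4 * c) S {{m*n≢0 4 c}}}} (begin
      (c + d) ^ S * (4 * c) ^ S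
        ≡⟨ ^-distribʳ-* S (c + d) (4 * c) ⟨
      ((c + d) * (4 * c)) ^ S
        ≤⟨ ^-monoˡ-≤ S (≤-trans (m≤m+n _ (d * d)) (≤-reflexive (4c[c+d]≤ c d))) ⟩
      ((2 * c + d) * (2 * c + d)) ^ S
        ≡⟨ ^-distribʳ-* S (2 * c + d) (2 * c + d) ⟩
      (2 * c + d) ^ S * (2 * c + d) ^ S
        ≤⟨ *-mono-≤ h h ⟩
      (2 * c) ^ S * 2 ^ T * ((2 * c) ^ S * 2 ^ T)
        ≡⟨ swap ((2 * c) ^ S) (2 ^ T) ((2 * c) ^ S) (2 ^ T) ⟩
      (2 * c) ^ S * (2 * c) ^ S * (2 ^ T * 2 ^ T)
        ≡⟨ cong (_* (2 ^ T * 2 ^ T)) (trans (sym (^-distribʳ-* S (2 * c) (2 * c)))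
             (trans (cong (_^ S) (2c*2c c)) (^-distribʳ-* S c (4 * c)))) ⟩
      c ^ S * (4 * c) ^ S * (2 ^ T * 2 ^ T)
        ≡⟨ swap′ (c ^ S) ((4 * c) ^ S) (2 ^ T * 2 ^ T) ⟩
      c ^ S * (2 ^ T * 2 ^ T) * (4 * c) ^ S ∎)

  -- If (1 + 2 x) ^ (d S) ≤ 2 ^ (2 c T), where x = c / d, and 2 ^ (a / b) ≤ 1 + x,
  -- then a / b ≤ 2 x T / S.
  log-boundᵠ : ∀ {c d S T} a b .{{_ : NonZero d}} →
    ((2 * c + d) ^ d) ^ S ≤ (d ^ d) ^ S * (2 ^ T) ^ (2 * c) →
    2 ^ a * d ^ b ≤ (c + d) ^ b → a * (d * S) ≤ 2 * c * T * b
  log-boundᵠ {c} {d} {S} {T} a b h 2^a≤ =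
    2^-cancel-≤ (*-cancelʳ-≤ _ _ (d ^ (b * (d * S))) {{m^n≢0 d (b * (d * S))}} (begin
    2 ^ (a * (d * S)) * d ^ (b * (d * S))
      ≡⟨ cong₂ _*_ (^-*-assoc 2 a (d * S)) (^-*-assoc d b (d * S)) ⟨
    (2 ^ a) ^ (d * S) * (d ^ b) ^ (d * S)
      ≡⟨ ^-distribʳ-* (d * S) (2 ^ a) (d ^ b) ⟨
    (2 ^ a * d ^ b) ^ (d * S)
      ≤⟨ ^-monoˡ-≤ (d * S) (≤-trans 2^a≤ (^-monoˡ-≤ b (+-monoˡ-≤ d (m≤m+n c (c + 0))))) ⟩
    ((2 * c + d) ^ b) ^ (d * S)
      ≡⟨ trans (^-*-assoc (2 * c + d) b (d * S)) (trans (cong ((2 * c + d) ^_) (*-comm b (d * S)))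
           (trans (sym (^-*-assoc (2 * c + d) (d * S) b))
               (cong (_^ b) (sym (^-*-assoc (2 * c + d) d S))))) ⟩
    (((2 * c + d) ^ d) ^ S) ^ b
      ≤⟨ ^-monoˡ-≤ b h ⟩
    ((d ^ d) ^ S * (2 ^ T) ^ (2 * c)) ^ b
      ≡⟨ ^-distribʳ-* b ((d ^ d) ^ S) _ ⟩
    ((d ^ d) ^ S) ^ b * ((2 ^ T) ^ (2 * c)) ^ b
      ≡⟨ cong₂ _*_ (trans (cong (_^ b) (^-*-assoc d d S))
          (trans (^-*-assoc d (d * S) b) (cong (d ^_) (*-comm (d * S) b))))
                   (trans (cong (_^ b) (trans (^-*-assoc 2 T (2 * c))
                       (cong (2 ^_) (*-comm T (2 * c))))) (^-*-assoc 2 (2 * c * T) b)) ⟩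
    d ^ (b * (d * S)) * 2 ^ (2 * c * T * b)
      ≡⟨ *-comm (d ^ (b * (d * S))) _ ⟩
    2 ^ (2 * c * T * b) * d ^ (b * (d * S)) ∎))
    where open ≤-Reasoning

  -- Multiplying the bounds over the layers

  module _ (q : ℕ → ℕ) (q-mono : ∀ k → q k ≤ q (suc k)) where
    open Colourings q q-mono

    q₀≤qₖ : ∀ k → q 0 ≤ q k
    q₀≤qₖ zero    = ≤-refl
    q₀≤qₖ (suc k) = ≤-trans (q₀≤qₖ k) (q-mono k)

    -- The bounds for single colours multiply while the layer sizes telescope in the exponents. The
    -- exponent e lets one induction serve both binomial bounds, with e = 1 and e = 2 c.
    colourings-bound : ∀ x y e k →
      (∀ j → j < k → let s = q (suc j) ∸ q j in x ^ s ≤ y ^ s * ((q j + s) C s) ^ e) →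
      x ^ (q k ∸ q 0) ≤ y ^ (q k ∸ q 0) * length (colourings k) ^ e
    colourings-bound x y e zero    h rewrite n∸n≡0 (q 0) | ^-zeroˡ e = ≤-refl
    colourings-bound x y e (suc k) h = begin
      x ^ (q (suc k) ∸ q 0)
        ≡⟨ cong (x ^_) telescope ⟩
      x ^ (S + s)
        ≡⟨ ^-distribˡ-+-* x S s ⟩
      x ^ S * x ^ s
        ≤⟨ *-mono-≤ (colourings-bound x y e k (λ j j<k → h j (m≤n⇒m≤1+n j<k))) (h k ≤-refl) ⟩
      y ^ S * L ^ e * (y ^ s * N ^ e)
        ≡⟨ swap (y ^ S) (L ^ e) (y ^ s) (N ^ e) ⟩
      y ^ S * y ^ s * (L ^ e * N ^ e)
        ≡⟨ cong₂ _*_ (^-distribˡ-+-* y S s)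
            (trans (cong (_^ e) (length-colourings k)) (^-distribʳ-* e L N)) ⟨
      y ^ (S + s) * length (colourings (suc k)) ^ e
        ≡⟨ cong (λ r → y ^ r * length (colourings (suc k)) ^ e) telescope ⟨
      y ^ (q (suc k) ∸ q 0) * length (colourings (suc k)) ^ e ∎
      where
      open ≤-Reasoning
      S = q k ∸ q 0
      s = q (suc k) ∸ q k
      L = length (colourings k)
      N = (q k + s) C s

      telescope : q (suc k) ∸ q 0 ≡ S + s
      telescope = trans (cong (_∸ q 0) (sym (m+[n∸m]≡n (q-mono k)))) (+-∸-comm s (q₀≤qₖ k))

      swap : ∀ a b c d → a * b * (c * d) ≡ a * c * (b * d)
      swap = solve-∀

  module _ (p : ℕ → ℕ) (p-< : ∀ i → p i < p (suc i))
           {n} (A : DecisionTree n) (lohifies : LOHifies p A)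
           {T} (≤T : ∀ a → comparisons A a ≤ T)
           {c d} .{{_ : NonZero c}} (i₀ : ℕ) (p≤n : p i₀ ≤ n)
           (growth : ∀ i → i₀ ≤ i → i < i₀ + n → d * (p (suc i) ∸ p i) ≤ 2 * c * p i) where

    private
      q′      = q p p-< A lohifies i₀
      q′-mono = q-mono p p-< A lohifies i₀
      open Colourings q′ q′-mono

      q₀≡ : q′ 0 ≡ p i₀
      q₀≡ = trans (cong (λ i → p i ⊓ n) (+-identityʳ i₀)) (m≤n⇒m⊓n≡m p≤n)

      -- Since each pivot is at least its index, n further colours exhaust the array.
      qₙ≡ : q′ n ≡ n
      qₙ≡ = m≥n⇒m⊓n≡n (≤-trans (i≤pᵢ p p-< n) (p-mono p p-< (≤⇒≤′ (m≤n+m n i₀))))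

      -- The cap at n preserves the growth condition: a layer starting at or beyond n becomes empty,
      -- and any other can only shrink.
      q-growth : ∀ j → j < n → d * (q′ (suc j) ∸ q′ j) ≤ 2 * c * q′ j
      q-growth j j<n with ≤-total n (p (i₀ + j))
      ... | inj₁ n≤p = ≤-trans (≤-reflexive (trans (cong (d *_) (m≤n⇒m∸n≡0 (begin
          q′ (suc j) ≤⟨ m⊓n≤n (p (i₀ + suc j)) n ⟩
          n          ≡⟨ m≥n⇒m⊓n≡n n≤p ⟨
          q′ j       ∎))) (*-zeroʳ d))) z≤n
        where open ≤-Reasoning
      ... | inj₂ p≤n = begin
          d * (q′ (suc j) ∸ q′ j)
            ≡⟨ cong (λ r → d * (q′ (suc j) ∸ r)) (m≤n⇒m⊓n≡m p≤n) ⟩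
          d * (q′ (suc j) ∸ p (i₀ + j))
            ≤⟨ *-monoʳ-≤ d (∸-monoˡ-≤ (p (i₀ + j))
                (≤-trans (m⊓n≤m (p (i₀ + suc j)) n) (≤-reflexive (cong p (+-suc i₀ j))))) ⟩
          d * (p (suc (i₀ + j)) ∸ p (i₀ + j))
            ≤⟨ growth (i₀ + j) (m≤m+n i₀ j) (+-monoʳ-< i₀ j<n) ⟩
          2 * c * p (i₀ + j)
            ≡⟨ cong (2 * c *_) (m≤n⇒m⊓n≡m p≤n) ⟨
          2 * c * q′ j ∎
        where open ≤-Reasoning

      tree-bound : ∀ x y e →
        (∀ j → j < n → let s = q′ (suc j) ∸ q′ j in x ^ s ≤ y ^ s * ((q′ j + s) C s) ^ e) →
        x ^ (n ∸ p i₀) ≤ y ^ (n ∸ p i₀) * (2 ^ T) ^ e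
      tree-bound x y e h = begin
        x ^ (n ∸ p i₀)     ≡⟨ cong (x ^_) (cong₂ _∸_ qₙ≡ q₀≡) ⟨
        x ^ (q′ n ∸ q′ 0)  ≤⟨ colourings-bound q′ q′-mono x y e n h ⟩
        y ^ (q′ n ∸ q′ 0) * length (colourings n) ^ e
          ≡⟨ cong (λ r → y ^ r * length (colourings n) ^ e) (cong₂ _∸_ qₙ≡ q₀≡) ⟩
        y ^ (n ∸ p i₀) * length (colourings n) ^ e
          ≤⟨ *-monoʳ-≤ (y ^ (n ∸ p i₀))
              (^-monoˡ-≤ e (length-colourings≤2^T p p-< A lohifies i₀ n T qₙ≡ ≤T)) ⟩
        y ^ (n ∸ p i₀) * (2 ^ T) ^ e ∎
        where open ≤-Reasoning

    comparisons-boundˢ : (2 * c + d) ^ (n ∸ p i₀) ≤ (2 * c) ^ (n ∸ p i₀) * 2 ^ T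
    comparisons-boundˢ = ≤-trans
      (tree-bound (2 * c + d) (2 * c) 1 λ j j<n → ≤-trans
        (binomial-boundˢ c d (q′ j) (q′ (suc j) ∸ q′ j) (q-growth j j<n))
        (≤-reflexive (cong ((2 * c) ^ (q′ (suc j) ∸ q′ j) *_) (sym (^-identityʳ _)))))
      (≤-reflexive (cong ((2 * c) ^ (n ∸ p i₀) *_) (^-identityʳ (2 ^ T))))

    comparisons-boundᵠ : ((2 * c + d) ^ d) ^ (n ∸ p i₀) ≤ (d ^ d) ^ (n ∸ p i₀) * (2 ^ T) ^ (2 * c)
    comparisons-boundᵠ = tree-bound ((2 * c + d) ^ d) (d ^ d) (2 * c) λ j j<n →
      let s = q′ (suc j) ∸ q′ j in ≤-trans
        (≤-reflexive (^-*-assoc (2 * c + d) d s))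
        (≤-trans (binomial-boundᵠ c d (q′ j) s (q-growth j j<n))
          (≤-reflexive (cong (_* ((q′ j + s) C s) ^ (2 * c)) (sym (^-*-assoc d d s)))))

open import Data.Empty using (⊥)
open import Data.Integer.Base as ℤ using (+_; -[1+_]; _⊖_; ℤ)
import Data.Integer.Properties as ℤ
open import Data.Nat.Base as ℕ using (suc; zero; ℕ)
import Data.Nat.Properties as ℕ
open import Data.Product.Base using (_,_; _×_; proj₁; proj₂; ∃-syntax)
open import Data.Rational.Base
open import Data.Rational.Properties
open import Data.Rational.Solver using (module +-*-Solver)
import Data.Rational.Unnormalised.Base as ℚᵘ
import Data.Rational.Unnormalised.Properties as ℚᵘ
open import Data.Sum.Base using (inj₁; inj₂)
open import Defs
open import Relation.Binary.PropositionalEquality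
open Counting using (i≤pᵢ; log-boundˢ; log-boundᵠ; comparisons-boundˢ; comparisons-boundᵠ)

-- Naturals, integers and powers of two inside ℚ

ι : ℕ → ℚ
ι n = + n / 1

infixr 8 _^ℚ_

_^ℚ_ : ℚ → ℕ → ℚ
p ^ℚ zero  = 1ℚ
p ^ℚ suc n = p * p ^ℚ n

/1-homo-+ : ∀ i j → (i ℤ.+ j) / 1 ≡ i / 1 + j / 1
/1-homo-+ i j = toℚᵘ-injective (begin
  toℚᵘ ((i ℤ.+ j) / 1)              ≈⟨ toℚᵘ-fromℚᵘ (ℚᵘ.mkℚᵘ (i ℤ.+ j) 0) ⟩
  ℚᵘ.mkℚᵘ (i ℤ.+ j) 0
    ≈⟨ ℚᵘ.*≡* (cong (λ r → r ℤ.* + 1)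
        (cong₂ ℤ._+_ (sym (ℤ.*-identityʳ i)) (sym (ℤ.*-identityʳ j)))) ⟩
  ℚᵘ.mkℚᵘ i 0 ℚᵘ.+ ℚᵘ.mkℚᵘ j 0
    ≈⟨ ℚᵘ.+-cong (toℚᵘ-fromℚᵘ (ℚᵘ.mkℚᵘ i 0)) (toℚᵘ-fromℚᵘ (ℚᵘ.mkℚᵘ j 0)) ⟨
  toℚᵘ (i / 1) ℚᵘ.+ toℚᵘ (j / 1)    ≈⟨ toℚᵘ-homo-+ (i / 1) (j / 1) ⟨
  toℚᵘ (i / 1 + j / 1)              ∎)
  where open ℚᵘ.≃-Reasoning

/1-homo-* : ∀ i j → (i ℤ.* j) / 1 ≡ (i / 1) * (j / 1)
/1-homo-* i j = toℚᵘ-injective (begin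
  toℚᵘ ((i ℤ.* j) / 1)              ≈⟨ toℚᵘ-fromℚᵘ (ℚᵘ.mkℚᵘ (i ℤ.* j) 0) ⟩
  ℚᵘ.mkℚᵘ i 0 ℚᵘ.* ℚᵘ.mkℚᵘ j 0
    ≈⟨ ℚᵘ.*-cong (toℚᵘ-fromℚᵘ (ℚᵘ.mkℚᵘ i 0)) (toℚᵘ-fromℚᵘ (ℚᵘ.mkℚᵘ j 0)) ⟨
  toℚᵘ (i / 1) ℚᵘ.* toℚᵘ (j / 1)    ≈⟨ toℚᵘ-homo-* (i / 1) (j / 1) ⟨
  toℚᵘ ((i / 1) * (j / 1))          ∎)
  where open ℚᵘ.≃-Reasoning

i/n*n≡i : ∀ i n .{{_ : ℕ.NonZero n}} → (i / n) * ι n ≡ i / 1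
i/n*n≡i i n@(suc n-1) = toℚᵘ-injective (begin
  toℚᵘ ((i / n) * ι n)              ≈⟨ toℚᵘ-homo-* (i / n) (ι n) ⟩
  toℚᵘ (i / n) ℚᵘ.* toℚᵘ (ι n)
    ≈⟨ ℚᵘ.*-cong (toℚᵘ-fromℚᵘ (ℚᵘ.mkℚᵘ i n-1)) (toℚᵘ-fromℚᵘ (ℚᵘ.mkℚᵘ (+ n) 0)) ⟩
  ℚᵘ.mkℚᵘ i n-1 ℚᵘ.* ℚᵘ.mkℚᵘ (+ n) 0
    ≈⟨ ℚᵘ.*≡* (trans (ℤ.*-identityʳ (i ℤ.* + n)) (cong (λ k → i ℤ.* + k) (sym (ℕ.*-identityʳ n)))) ⟩
  ℚᵘ.mkℚᵘ i 0                       ≈⟨ toℚᵘ-fromℚᵘ (ℚᵘ.mkℚᵘ i 0) ⟨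
  toℚᵘ (i / 1)                      ∎)
  where open ℚᵘ.≃-Reasoning

/1-mono-≤ : ∀ {i j} → i ℤ.≤ j → i / 1 ≤ j / 1
/1-mono-≤ {i} {j} i≤j = toℚᵘ-cancel-≤ (begin
  toℚᵘ (i / 1)  ≃⟨ toℚᵘ-fromℚᵘ (ℚᵘ.mkℚᵘ i 0) ⟩
  ℚᵘ.mkℚᵘ i 0   ≤⟨ ℚᵘ.*≤* (ℤ.*-monoʳ-≤-nonNeg (+ 1) i≤j) ⟩
  ℚᵘ.mkℚᵘ j 0   ≃⟨ toℚᵘ-fromℚᵘ (ℚᵘ.mkℚᵘ j 0) ⟨
  toℚᵘ (j / 1)  ∎)
  where open ℚᵘ.≤-Reasoning

/1-cancel-≤ : ∀ {i j} → i / 1 ≤ j / 1 → i ℤ.≤ j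
/1-cancel-≤ {i} {j} i≤j = ℤ.*-cancelʳ-≤-pos i j (+ 1) (ℚᵘ.drop-*≤* (begin
  ℚᵘ.mkℚᵘ i 0   ≃⟨ toℚᵘ-fromℚᵘ (ℚᵘ.mkℚᵘ i 0) ⟨
  toℚᵘ (i / 1)  ≤⟨ toℚᵘ-mono-≤ i≤j ⟩
  toℚᵘ (j / 1)  ≃⟨ toℚᵘ-fromℚᵘ (ℚᵘ.mkℚᵘ j 0) ⟩
  ℚᵘ.mkℚᵘ j 0   ∎))
  where open ℚᵘ.≤-Reasoning

ι-homo-+ : ∀ m n → ι (m ℕ.+ n) ≡ ι m + ι n
ι-homo-+ m n = /1-homo-+ (+ m) (+ n)

ι-homo-* : ∀ m n → ι (m ℕ.* n) ≡ ι m * ι n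
ι-homo-* m n = trans (cong (_/ 1) (ℤ.pos-* m n)) (/1-homo-* (+ m) (+ n))

ι-homo-^ : ∀ m n → ι (m ℕ.^ n) ≡ ι m ^ℚ n
ι-homo-^ m zero    = refl
ι-homo-^ m (suc n) = trans (ι-homo-* m (m ℕ.^ n)) (cong (ι m *_) (ι-homo-^ m n))

ι-mono-≤ : ∀ {m n} → m ℕ.≤ n → ι m ≤ ι n
ι-mono-≤ m≤n = /1-mono-≤ (ℤ.+≤+ m≤n)

ι-cancel-≤ : ∀ {m n} → ι m ≤ ι n → m ℕ.≤ n
ι-cancel-≤ m≤n = ℤ.drop‿+≤+ (/1-cancel-≤ m≤n)

0≤ι : ∀ n → 0ℚ ≤ ι n
0≤ι n = ι-mono-≤ {0} {n} ℕ.z≤n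

0<ι : ∀ n .{{_ : ℕ.NonZero n}} → 0ℚ < ι n
0<ι n@(suc _) = <-≤-trans (positive⁻¹ 1ℚ) (ι-mono-≤ {1} {n} (ℕ.s≤s ℕ.z≤n))

*-mono-≤ : ∀ {p q r s} → 0ℚ ≤ r → 0ℚ ≤ q → p ≤ q → r ≤ s → p * r ≤ q * s
*-mono-≤ {p} {q} {r} {s} 0≤r 0≤q p≤q r≤s = ≤-trans
  (*-monoʳ-≤-nonNeg r {{nonNegative 0≤r}} p≤q)
  (*-monoˡ-≤-nonNeg q {{nonNegative 0≤q}} r≤s)

*-nonNeg : ∀ {p q} → 0ℚ ≤ p → 0ℚ ≤ q → 0ℚ ≤ p * q
*-nonNeg {p} {q} 0≤p 0≤q = subst (_≤ p * q) (*-zeroʳ p) (*-monoˡ-≤-nonNeg p {{nonNegative 0≤p}} 0≤q)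

^ℚ-nonNeg : ∀ {p} n → 0ℚ ≤ p → 0ℚ ≤ p ^ℚ n
^ℚ-nonNeg zero    0≤p = nonNegative⁻¹ 1ℚ
^ℚ-nonNeg (suc n) 0≤p = *-nonNeg 0≤p (^ℚ-nonNeg n 0≤p)

^ℚ-distrib-* : ∀ p q n → (p * q) ^ℚ n ≡ p ^ℚ n * q ^ℚ n
^ℚ-distrib-* p q zero    = refl
^ℚ-distrib-* p q (suc n) = trans (cong (p * q *_) (^ℚ-distrib-* p q n))
  (swap p q (p ^ℚ n) (q ^ℚ n))
  where
  open +-*-Solver
  swap : ∀ a b c d → a * b * (c * d) ≡ a * c * (b * d)
  swap = solve 4 (λ a b c d → a :* b :* (c :* d) := a :* c :* (b :* d)) refl

0≤2^ : ∀ i → 0ℚ ≤ 2^ i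
0≤2^ (+ n)    = 0≤ι (2 ℕ.^ n)
0≤2^ -[1+ n ] = nonNegative⁻¹ _ {{normalize-nonNeg 1 (2 ℕ.^ suc n) {{ℕ.m^n≢0 2 (suc n)}}}}

2^-[1+n]*2^[1+n]≡1 : ∀ n → 2^ -[1+ n ] * ι (2 ℕ.^ suc n) ≡ 1ℚ
2^-[1+n]*2^[1+n]≡1 n = i/n*n≡i (+ 1) (2 ℕ.^ suc n) {{ℕ.m^n≢0 2 (suc n)}}

2^-shift : ∀ m n {k} → m ⊖ suc n ≡ + k → ι (2 ℕ.^ k) ≡ ι (2 ℕ.^ m) * 2^ -[1+ n ]
2^-shift m n {k} eq = begin
  ι (2 ℕ.^ k)                                       ≡⟨ *-identityʳ _ ⟨
  ι (2 ℕ.^ k) * 1ℚ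
    ≡⟨ cong (ι (2 ℕ.^ k) *_) (trans (*-comm (ι P) _) (2^-[1+n]*2^[1+n]≡1 n)) ⟨
  ι (2 ℕ.^ k) * (ι P * 2^ -[1+ n ])                 ≡⟨ *-assoc (ι (2 ℕ.^ k)) _ _ ⟨
  ι (2 ℕ.^ k) * ι P * 2^ -[1+ n ]
    ≡⟨ cong (_* 2^ -[1+ n ]) (ι-homo-* (2 ℕ.^ k) P) ⟨
  ι (2 ℕ.^ k ℕ.* P) * 2^ -[1+ n ]
    ≡⟨ cong (λ r → ι r * 2^ -[1+ n ]) (ℕ.^-distribˡ-+-* 2 k (suc n)) ⟨
  ι (2 ℕ.^ (k ℕ.+ suc n)) * 2^ -[1+ n ]
    ≡⟨ cong (λ r → ι (2 ℕ.^ r) * 2^ -[1+ n ]) k+n≡m ⟩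
  ι (2 ℕ.^ m) * 2^ -[1+ n ]                         ∎
  where
  open ≡-Reasoning
  P = 2 ℕ.^ suc n

  k+n≡m : k ℕ.+ suc n ≡ m
  k+n≡m = ℤ.+-injective (begin
    + k ℤ.+ + suc n                   ≡⟨ cong (λ r → r ℤ.+ + suc n) eq ⟨
    (m ⊖ suc n) ℤ.+ + suc n           ≡⟨ cong (λ r → r ℤ.+ + suc n) (ℤ.m-n≡m⊖n m (suc n)) ⟨
    + m ℤ.- + suc n ℤ.+ + suc n       ≡⟨ ℤ.+-assoc (+ m) (ℤ.- + suc n) (+ suc n) ⟩
    + m ℤ.+ (ℤ.- + suc n ℤ.+ + suc n) ≡⟨ cong (λ r → + m ℤ.+ r) (ℤ.+-inverseˡ (+ suc n)) ⟩
    + m ℤ.+ + 0                       ≡⟨ ℤ.+-identityʳ (+ m) ⟩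
    + m                               ∎)

-- A nonnegative total exponent makes the product a natural number, as the bounds in ℕ require;
-- negative totals are settled by `scaled-bound`.
2^-homo-+ : ∀ i j {k} → i ℤ.+ j ≡ + k → ι (2 ℕ.^ k) ≡ 2^ i * 2^ j
2^-homo-+ (+ m)    (+ n)    refl = trans (cong ι (ℕ.^-distribˡ-+-* 2 m n))
    (ι-homo-* (2 ℕ.^ m) (2 ℕ.^ n))
2^-homo-+ (+ m)    -[1+ n ] eq   = 2^-shift m n eq
2^-homo-+ -[1+ n ] (+ m)    eq   = trans (2^-shift m n eq) (*-comm (ι (2 ℕ.^ m)) _)

-- Rational lower bounds for both logarithms are put over one denominator, so that both instances of
-- `IsLog₂` speak about the same power.
common-denominator : ∀ p q → ∃[ i ] ∃[ j ] ∃[ k ] p ≡ i / suc k × q ≡ j / suc k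
common-denominator p@(mkℚ i d-1 _) q@(mkℚ j e-1 _) =
  i ℤ.* + suc e-1 , j ℤ.* + suc d-1 , ℕ.pred (suc d-1 ℕ.* suc e-1) ,
  trans (sym (↥p/↧p≡p p)) (fromℚᵘ-cong {ℚᵘ.mkℚᵘ i d-1} {ℚᵘ.mkℚᵘ (i ℤ.* + suc e-1) _} (ℚᵘ.*≡* (begin
    i ℤ.* + (suc d-1 ℕ.* suc e-1)
      ≡⟨ cong (i ℤ.*_) (trans (ℤ.pos-* (suc d-1) (suc e-1)) (ℤ.*-comm (+ suc d-1) (+ suc e-1))) ⟩
    i ℤ.* (+ suc e-1 ℤ.* + suc d-1)       ≡⟨ ℤ.*-assoc i (+ suc e-1) (+ suc d-1) ⟨
    i ℤ.* + suc e-1 ℤ.* + suc d-1         ∎))) ,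
  trans (sym (↥p/↧p≡p q)) (fromℚᵘ-cong {ℚᵘ.mkℚᵘ j e-1} {ℚᵘ.mkℚᵘ (j ℤ.* + suc d-1) _} (ℚᵘ.*≡* (begin
    j ℤ.* + (suc d-1 ℕ.* suc e-1)         ≡⟨ cong (j ℤ.*_) (ℤ.pos-* (suc d-1) (suc e-1)) ⟩
    j ℤ.* (+ suc d-1 ℤ.* + suc e-1)       ≡⟨ ℤ.*-assoc j (+ suc d-1) (+ suc e-1) ⟨
    j ℤ.* + suc d-1 ℤ.* + suc e-1         ∎)))
  where open ≡-Reasoning

positive-fraction : ∀ {p} → 0ℚ < p → ∃[ c ] ∃[ d ] ι (suc c) ≡ ι (suc d) * p
positive-fraction {p@(mkℚ (+ suc c) d _)} 0<p = c , d ,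
  sym (trans (*-comm (ι (suc d)) p)
      (trans (cong (_* ι (suc d)) (sym (↥p/↧p≡p p))) (i/n*n≡i (+ suc c) (suc d))))
positive-fraction {mkℚ (+ zero) _ _} (*<* (ℤ.+<+ ()))
positive-fraction {mkℚ -[1+ _ ] _ _} (*<* ())

archimedean : ∀ {p} → 0ℚ < p → ∀ n → ∃[ k ] ι n ≤ p * ι k
-- With p = (c + 1) / (d + 1) and k = n (d + 1), the product p k equals n (c + 1).
archimedean {p} 0<p n with c , d , eq ← positive-fraction 0<p = n ℕ.* suc d , (begin
  ι n                     ≤⟨ ι-mono-≤ (ℕ.m≤m*n n (suc c)) ⟩
  ι (n ℕ.* suc c)         ≡⟨ ι-homo-* n (suc c) ⟩
  ι n * ι (suc c)         ≡⟨ cong (ι n *_) eq ⟩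
  ι n * (ι (suc d) * p)   ≡⟨ *-assoc (ι n) (ι (suc d)) p ⟨
  ι n * ι (suc d) * p     ≡⟨ cong (_* p) (ι-homo-* n (suc d)) ⟨
  ι (n ℕ.* suc d) * p     ≡⟨ *-comm _ p ⟩
  p * ι (n ℕ.* suc d)     ∎)
  where open ≤-Reasoning

≤-shift : ∀ p q r → p + q ≤ r → q ≤ r - p
≤-shift p q r h = subst (_≤ r - p) (cancel p q) (+-monoˡ-≤ (- p) h)
  where
  open +-*-Solver
  cancel : ∀ p q → p + q - p ≡ q
  cancel = solve 2 (λ p q → p :+ q :- p := q) refl

≤-unshift : ∀ p q r → q ≤ r - p → p + q ≤ r
≤-unshift p q r h = subst (p + q ≤_) (cancel p r) (+-monoʳ-≤ p h)
  where
  open +-*-Solver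
  cancel : ∀ p r → p + (r - p) ≡ r
  cancel = solve 2 (λ p r → p :+ (r :- p) := r) refl

-- Logarithm bounds over ℚ

-- A negative i makes the left side nonpositive, so only natural exponents carry content.
scaled-bound : ∀ i s t → (∀ k → i ≡ + k → k ℕ.* s ℕ.≤ t) → (i / 1) * ι s ≤ ι t
scaled-bound (+ k)    s t h = ≤-trans (≤-reflexive (sym (ι-homo-* k s)))
    (ι-mono-≤ {k ℕ.* s} {t} (h k refl))
scaled-bound -[1+ k ] s t h = begin
  (-[1+ k ] / 1) * ι s
    ≤⟨ *-monoʳ-≤-nonNeg (ι s) {{nonNegative (0≤ι s)}} (/1-mono-≤ { -[1+ k ]} {+ 0} ℤ.-≤+) ⟩
  0ℚ * ι s             ≡⟨ *-zeroˡ (ι s) ⟩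
  0ℚ                   ≤⟨ 0≤ι t ⟩
  ι t                  ∎
  where open ≤-Reasoning

-- Here x stands for α - 1 = c / d and y for 1 / (α - 1).
module _ {x y c d} .{{_ : ℕ.NonZero c}} .{{_ : ℕ.NonZero d}}
         (c≡dx : ι c ≡ ι d * x) (xy≡1 : x * y ≡ 1ℚ) (0≤y : 0ℚ ≤ y)
         {S T : ℕ} {b} .{{_ : ℕ.NonZero b}} where

  private
    c*y≡d : ι c * y ≡ ι d
    c*y≡d = begin
      ι c * y       ≡⟨ cong (_* y) c≡dx ⟩
      ι d * x * y   ≡⟨ *-assoc (ι d) x y ⟩
      ι d * (x * y) ≡⟨ cong (ι d *_) xy≡1 ⟩
      ι d * 1ℚ      ≡⟨ *-identityʳ (ι d) ⟩
      ι d           ∎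
      where open ≡-Reasoning

    d*[1+x]≡c+d : ι d * (1ℚ + x) ≡ ι (c ℕ.+ d)
    d*[1+x]≡c+d = begin
      ι d * (1ℚ + x)       ≡⟨ *-distribˡ-+ (ι d) 1ℚ x ⟩
      ι d * 1ℚ + ι d * x   ≡⟨ cong₂ _+_ (*-identityʳ (ι d)) (sym c≡dx) ⟩
      ι d + ι c            ≡⟨ +-comm (ι d) (ι c) ⟩
      ι c + ι d            ≡⟨ ι-homo-+ c d ⟨
      ι (c ℕ.+ d)          ∎
      where open ≡-Reasoning

    /b-bound : ∀ i s t → (i / 1) * ι s ≤ ι (t ℕ.* b) → (i / b) * ι s ≤ ι t
    /b-bound i s t h = *-cancelʳ-≤-pos (ι b) {{positive (0<ι b)}} (begin
      (i / b) * ι s * ι b     ≡⟨ *-assoc (i / b) (ι s) (ι b) ⟩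
      (i / b) * (ι s * ι b)   ≡⟨ cong ((i / b) *_) (*-comm (ι s) (ι b)) ⟩
      (i / b) * (ι b * ι s)   ≡⟨ *-assoc (i / b) (ι b) (ι s) ⟨
      (i / b) * ι b * ι s     ≡⟨ cong (_* ι s) (i/n*n≡i i b) ⟩
      (i / 1) * ι s           ≤⟨ h ⟩
      ι (t ℕ.* b)             ≡⟨ ι-homo-* t b ⟩
      ι t * ι b               ∎)
      where open ≤-Reasoning

    i/b+j/b : ∀ i j → i / b + j / b ≡ (i ℤ.+ j) / b
    i/b+j/b i j = ≤-antisym (≤-reflexive eq) (≤-reflexive (sym eq))
      where
      open ≡-Reasoning
      eq : i / b + j / b ≡ (i ℤ.+ j) / b
      eq = *-cancelʳ-≡ (begin
        (i / b + j / b) * ι b         ≡⟨ *-distribʳ-+ (ι b) (i / b) (j / b) ⟩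
        (i / b) * ι b + (j / b) * ι b ≡⟨ cong₂ _+_ (i/n*n≡i i b) (i/n*n≡i j b) ⟩
        i / 1 + j / 1                 ≡⟨ /1-homo-+ i j ⟨
        (i ℤ.+ j) / 1                 ≡⟨ i/n*n≡i (i ℤ.+ j) b ⟨
        ((i ℤ.+ j) / b) * ι b         ∎)
        where
        *-cancelʳ-≡ : ∀ {p q} → p * ι b ≡ q * ι b → p ≡ q
        *-cancelʳ-≡ h = ≤-antisym
          (*-cancelʳ-≤-pos (ι b) {{positive (0<ι b)}} (≤-reflexive h))
          (*-cancelʳ-≤-pos (ι b) {{positive (0<ι b)}} (≤-reflexive (sym h)))

  -- Multiplying the two hypotheses bounds 2 ^ (i + j) by (y (1 + x)) ^ b, and y (1 + x) = 1 + y =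
  -- (c + d) / c is the quantity in `log-boundˢ`.
  ℚ-log-boundˢ : ∀ i j →
    (2 ℕ.* c ℕ.+ d) ℕ.^ S ℕ.≤ (2 ℕ.* c) ℕ.^ S ℕ.* 2 ℕ.^ T →
    2^ i ≤ y ^ℚ b → 2^ j ≤ (1ℚ + x) ^ℚ b →
    (i / b + j / b) * ι S ≤ ι (2 ℕ.* T)
  ℚ-log-boundˢ i j h 2^i≤ 2^j≤ = ≤-trans
    (≤-reflexive (cong (_* ι S) (i/b+j/b i j)))
    (/b-bound (i ℤ.+ j) S (2 ℕ.* T) (scaled-bound (i ℤ.+ j) S (2 ℕ.* T ℕ.* b) λ k eq →
      log-boundˢ {c} {d} {S} {T} k b h (ι-cancel-≤ (begin
        ι (2 ℕ.^ k ℕ.* c ℕ.^ b)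
          ≡⟨ trans (ι-homo-* (2 ℕ.^ k) (c ℕ.^ b)) (cong₂ _*_ (2^-homo-+ i j eq) (ι-homo-^ c b)) ⟩
        2^ i * 2^ j * ι c ^ℚ b
          ≤⟨ *-monoʳ-≤-nonNeg (ι c ^ℚ b) {{nonNegative (^ℚ-nonNeg b (0≤ι c))}}
               (*-mono-≤ (0≤2^ j) (^ℚ-nonNeg b 0≤y) 2^i≤ 2^j≤) ⟩
        y ^ℚ b * (1ℚ + x) ^ℚ b * ι c ^ℚ b
          ≡⟨ trans (cong (_* ι c ^ℚ b) (sym (^ℚ-distrib-* y (1ℚ + x) b)))
              (sym (^ℚ-distrib-* (y * (1ℚ + x)) (ι c) b)) ⟩
        (y * (1ℚ + x) * ι c) ^ℚ b
          ≡⟨ cong (_^ℚ b) (trans (rotate y (1ℚ + x) (ι c))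
              (trans (cong (_* (1ℚ + x)) c*y≡d) d*[1+x]≡c+d)) ⟩
        ι (c ℕ.+ d) ^ℚ b
          ≡⟨ ι-homo-^ (c ℕ.+ d) b ⟨
        ι ((c ℕ.+ d) ℕ.^ b) ∎))))
    where
    open ≤-Reasoning
    rotate : ∀ p q r → p * q * r ≡ r * p * q
    rotate = solve 3 (λ p q r → p :* q :* r := r :* p :* q) refl
      where open +-*-Solver

  -- Multiplying `log-boundᵠ` by y = d / c turns 2 c T into 2 d T, after which the factor d cancels.
  ℚ-log-boundᵠ : ∀ j →
    ((2 ℕ.* c ℕ.+ d) ℕ.^ d) ℕ.^ S ℕ.≤ (d ℕ.^ d) ℕ.^ S ℕ.* (2 ℕ.^ T) ℕ.^ (2 ℕ.* c) →
    2^ j ≤ (1ℚ + x) ^ℚ b → (j / b) * y * ι S ≤ ι (2 ℕ.* T)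
  ℚ-log-boundᵠ j h 2^j≤ = *-cancelʳ-≤-pos (ι d) {{positive (0<ι d)}} (begin
    (j / b) * y * ι S * ι d
      ≡⟨ rotate (j / b) y (ι S) (ι d) ⟩
    (j / b) * (ι d * ι S) * y
      ≡⟨ cong (λ r → (j / b) * r * y) (ι-homo-* d S) ⟨
    (j / b) * ι (d ℕ.* S) * y
      ≤⟨ *-monoʳ-≤-nonNeg y {{nonNegative 0≤y}} (/b-bound j (d ℕ.* S) (2 ℕ.* c ℕ.* T)
           (scaled-bound j (d ℕ.* S) (2 ℕ.* c ℕ.* T ℕ.* b) λ k eq →
             log-boundᵠ {c} {d} {S} {T} k b h (ι-cancel-≤ (in-ℚ k eq)))) ⟩
    ι (2 ℕ.* c ℕ.* T) * y
      ≡⟨ cong (_* y) (trans (ι-homo-* (2 ℕ.* c) T) (cong (_* ι T) (ι-homo-* 2 c))) ⟩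
    ι 2 * ι c * ι T * y
      ≡⟨ regroup (ι 2) (ι c) (ι T) y ⟩
    ι 2 * ι T * (ι c * y)
      ≡⟨ cong₂ _*_ (sym (ι-homo-* 2 T)) c*y≡d ⟩
    ι (2 ℕ.* T) * ι d ∎)
    where
    open ≤-Reasoning

    in-ℚ : ∀ k → j ≡ + k → ι (2 ℕ.^ k ℕ.* d ℕ.^ b) ≤ ι ((c ℕ.+ d) ℕ.^ b)
    in-ℚ k refl = begin
      ι (2 ℕ.^ k ℕ.* d ℕ.^ b)
        ≡⟨ trans (ι-homo-* (2 ℕ.^ k) (d ℕ.^ b)) (cong (ι (2 ℕ.^ k) *_) (ι-homo-^ d b)) ⟩
      ι (2 ℕ.^ k) * ι d ^ℚ b
        ≤⟨ *-monoʳ-≤-nonNeg (ι d ^ℚ b) {{nonNegative (^ℚ-nonNeg b (0≤ι d))}} 2^j≤ ⟩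
      (1ℚ + x) ^ℚ b * ι d ^ℚ b
        ≡⟨ trans (sym (^ℚ-distrib-* (1ℚ + x) (ι d) b))
            (cong (_^ℚ b) (trans (*-comm (1ℚ + x) (ι d)) d*[1+x]≡c+d)) ⟩
      ι (c ℕ.+ d) ^ℚ b
        ≡⟨ ι-homo-^ (c ℕ.+ d) b ⟨
      ι ((c ℕ.+ d) ℕ.^ b) ∎

    rotate : ∀ p q r s → p * q * r * s ≡ p * (s * r) * q
    rotate = solve 4 (λ p q r s → p :* q :* r :* s := p :* (s :* r) :* q) refl
      where open +-*-Solver

    regroup : ∀ p q r s → p * q * r * s ≡ p * r * (q * s)
    regroup = solve 4 (λ p q r s → p :* q :* r :* s := p :* r :* (q :* s)) refl
      where open +-*-Solver

-- The bound of the theorem at one rational approximation: u and v approximate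
-- the logarithms, U and V bound them from below up to the error 3 η.
approximate-bound : ∀ {n S T : ℕ} {x y u v U V η : ℚ} →
  n ℕ.≤ 2 ℕ.* S → x * y ≡ 1ℚ → 0ℚ ≤ x → 0ℚ ≤ y → 0ℚ ≤ η →
  u ≤ U + ι 3 * η → v ≤ V + ι 3 * η →
  (U + V) * ι S ≤ ι (2 ℕ.* T) → V * y * ι S ≤ ι (2 ℕ.* T) →
  ι n * u + ι n * (1ℚ + x) * v * y ≤ ι 8 * ι T + η * (ι 3 * ι n * (ι 2 + y))
approximate-bound {n} {S} {T} {x} {y} {u} {v} {U} {V} {η} n≤2S xy≡1 0≤x 0≤y 0≤η u≤ v≤ h₁ h₂ = begin
  ι n * u + ι n * (1ℚ + x) * v * y
    ≤⟨ +-mono-≤ (*-monoˡ-≤-nonNeg (ι n) {{nonNegative (0≤ι n)}} u≤)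
         (*-monoʳ-≤-nonNeg y {{nonNegative 0≤y}}
           (*-monoˡ-≤-nonNeg (ι n * (1ℚ + x)) {{nonNegative (*-nonNeg (0≤ι n) 0≤1+x)}} v≤)) ⟩
  ι n * (U + ι 3 * η) + ι n * (1ℚ + x) * (V + ι 3 * η) * y
    ≡⟨ expand (ι n) U V η x y ⟩
  ι n * (U + ι 3 * η) + ι n * (V + ι 3 * η) * (y + x * y)
    ≡⟨ cong (λ r → ι n * (U + ι 3 * η) + ι n * (V + ι 3 * η) * (y + r)) xy≡1 ⟩
  ι n * (U + ι 3 * η) + ι n * (V + ι 3 * η) * (y + 1ℚ)
    ≡⟨ collect (ι n) U V η y ⟩
  ι n * Q + η * (ι 3 * ι n * (ι 2 + y))
    ≤⟨ +-monoˡ-≤ _ nQ≤8T ⟩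
  ι 8 * ι T + η * (ι 3 * ι n * (ι 2 + y)) ∎
  where
  open ≤-Reasoning
  Q = U + V + V * y

  0≤1+x : 0ℚ ≤ 1ℚ + x
  0≤1+x = ≤-trans (nonNegative⁻¹ 1ℚ) (subst (_≤ 1ℚ + x) (+-identityʳ 1ℚ) (+-monoʳ-≤ 1ℚ 0≤x))

  expand : ∀ n U V η x y → n * (U + ι 3 * η) + n * (1ℚ + x) * (V + ι 3 * η) * y ≡
                           n * (U + ι 3 * η) + n * (V + ι 3 * η) * (y + x * y)
  expand = solve 6 (λ n U V η x y →
    n :* (U :+ con (ι 3) :* η) :+ n :* (con 1ℚ :+ x) :* (V :+ con (ι 3) :* η) :* y :=
    n :* (U :+ con (ι 3) :* η) :+ n :* (V :+ con (ι 3) :* η) :* (y :+ x :* y)) refl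
    where open +-*-Solver

  collect : ∀ n U V η y → n * (U + ι 3 * η) + n * (V + ι 3 * η) * (y + 1ℚ) ≡
                          n * (U + V + V * y) + η * (ι 3 * n * (ι 2 + y))
  collect = solve 5 (λ n U V η y →
    n :* (U :+ con (ι 3) :* η) :+ n :* (V :+ con (ι 3) :* η) :* (y :+ con 1ℚ) :=
    n :* (U :+ V :+ V :* y) :+ η :* (con (ι 3) :* n :* (con (ι 2) :+ y))) refl
    where open +-*-Solver

  QS≤4T : Q * ι S ≤ ι 4 * ι T
  QS≤4T = begin
    Q * ι S                     ≡⟨ *-distribʳ-+ (ι S) (U + V) (V * y) ⟩
    (U + V) * ι S + V * y * ι S ≤⟨ +-mono-≤ h₁ h₂ ⟩
    ι (2 ℕ.* T) + ι (2 ℕ.* T)   ≡⟨ cong₂ _+_ (ι-homo-* 2 T) (ι-homo-* 2 T) ⟩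
    ι 2 * ι T + ι 2 * ι T       ≡⟨ *-distribʳ-+ (ι T) (ι 2) (ι 2) ⟨
    ι 4 * ι T                   ∎

  nQ≤8T : ι n * Q ≤ ι 8 * ι T
  -- Replacing n by the larger 2 S requires Q ≥ 0; lower approximations of logarithms may make Q
  -- negative, and then the claim is trivial. The 8 is this 2 times the 4 of `QS≤4T`.
  nQ≤8T with ≤-total Q 0ℚ
  ... | inj₁ Q≤0 = begin
    ι n * Q    ≤⟨ *-monoˡ-≤-nonNeg (ι n) {{nonNegative (0≤ι n)}} Q≤0 ⟩
    ι n * 0ℚ   ≡⟨ *-zeroʳ (ι n) ⟩
    0ℚ         ≤⟨ *-nonNeg (0≤ι 8) (0≤ι T) ⟩
    ι 8 * ι T  ∎
  ... | inj₂ 0≤Q = begin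
    ι n * Q          ≤⟨ *-monoʳ-≤-nonNeg Q {{nonNegative 0≤Q}} (ι-mono-≤ {n} {2 ℕ.* S} n≤2S) ⟩
    ι (2 ℕ.* S) * Q  ≡⟨ cong (_* Q) (ι-homo-* 2 S) ⟩
    ι 2 * ι S * Q    ≡⟨ trans (*-assoc (ι 2) (ι S) Q) (cong (ι 2 *_) (*-comm (ι S) Q)) ⟩
    ι 2 * (Q * ι S)  ≤⟨ *-monoˡ-≤-nonNeg (ι 2) QS≤4T ⟩
    ι 2 * (ι 4 * ι T) ≡⟨ *-assoc (ι 2) (ι 4) (ι T) ⟨
    ι 8 * ι T        ∎

-- Real inequalities at late indices

Eventually : (ℕ → Set) → Set
Eventually P = ∃[ N ] ∀ m → N ℕ.≤ m → P m

eventually-map : ∀ {P Q : ℕ → Set} → (∀ m → P m → Q m) → Eventually P → Eventually Q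
eventually-map f (N , h) = N , λ m N≤m → f m (h m N≤m)

eventually-× : ∀ {P Q : ℕ → Set} → Eventually P → Eventually Q → Eventually (λ m → P m × Q m)
eventually-× (M , g) (N , h) = M ℕ.⊔ N , λ m ≤m →
  g m (ℕ.m⊔n≤o⇒m≤o M N ≤m) , h m (ℕ.m⊔n≤o⇒n≤o M N ≤m)

eventually-∀< : ∀ {P : ℕ → ℕ → Set} → (∀ i → Eventually (P i)) →
  ∀ n → Eventually (λ m → ∀ i → i ℕ.< n → P i m)
eventually-∀<     h zero    = 0 , λ _ _ _ ()
eventually-∀< {P} h (suc n) = eventually-map join (eventually-× (eventually-∀< h n) (h n))
  where
  join : ∀ m → (∀ i → i ℕ.< n → P i m) × P n m → ∀ i → i ℕ.< suc n → P i m
  join m (below , here) i (ℕ.s≤s i≤n) with ℕ.m≤n⇒m<n∨m≡n i≤n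
  ... | inj₁ i<n  = below i i<n
  ... | inj₂ refl = here

eventually-∃ : ∀ {P : ℕ → Set} → Eventually P → ∃[ m ] P m
eventually-∃ (N , h) = N , h N ℕ.≤-refl

∣p-q∣<r⇒p≤q+r : ∀ p q r → ∣ p - q ∣ < r → p ≤ q + r
∣p-q∣<r⇒p≤q+r p q r h =
  subst (_≤ q + r) (cancel p q) (+-monoʳ-≤ q (≤-trans (p≤∣p∣ (p - q)) (<⇒≤ h)))
  where
  cancel : ∀ p q → q + (p - q) ≡ p
  cancel = solve 2 (λ p q → q :+ (p :- q) := p) refl
    where open +-*-Solver

  p≤∣p∣ : ∀ p → p ≤ ∣ p ∣
  p≤∣p∣ p with ≤-total 0ℚ p
  ... | inj₁ 0≤p = ≤-reflexive (sym (0≤p⇒∣p∣≡p 0≤p))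
  ... | inj₂ p≤0 = ≤-trans p≤0 (0≤∣p∣ p)

½*-pos : ∀ {ε} → 0ℚ < ε → 0ℚ < ½ * ε
½*-pos {ε} 0<ε = subst (_< ½ * ε) (*-zeroʳ ½) (*-monoʳ-<-pos ½ 0<ε)

-- If x exceeded y by more than ε at one late index, the Cauchy property would keep an excess of ε /
-- 2 at all later ones, which is `y <ᵣ x`.
≤ᵣ⇒eventually : ∀ {x y} → x ≤ᵣ y → ∀ {ε} → 0ℚ < ε → Eventually (λ m → seq x m ≤ seq y m + ε)
≤ᵣ⇒eventually {x} {y} x≤y {ε} 0<ε = from-modulus (isCauchy (x -ᵣ y) (½ * ε) (½*-pos 0<ε))
  where
  d : ℕ → ℚ
  d k = seq x k - seq y k

  halves : ∀ ε → ε ≡ ½ * ε + ½ * ε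
  halves ε = trans (sym (*-identityˡ ε)) (*-distribʳ-+ ε ½ ½)

  cancel : ∀ p q → p + q - q ≡ p
  cancel = solve 2 (λ p q → p :+ q :- q := p) refl
    where open +-*-Solver

  from-modulus : ∃[ N ] (∀ m k → N ℕ.≤ m → N ℕ.≤ k → ∣ d m - d k ∣ < ½ * ε) →
    Eventually (λ m → seq x m ≤ seq y m + ε)
  from-modulus (N , hN) = N , λ m N≤m → ≮⇒≥ λ y+ε<x → x≤y (½ * ε , ½*-pos 0<ε , N , λ k N≤k →
    subst (½ * ε ≤_) (cancel (d k) (½ * ε)) (≤-shift (½ * ε) (½ * ε) (d k + ½ * ε) (begin
      ½ * ε + ½ * ε           ≡⟨ halves ε ⟨
      ε                       ≤⟨ ≤-shift (seq y m) ε (seq x m) (<⇒≤ y+ε<x) ⟩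
      d m                     ≤⟨ ∣p-q∣<r⇒p≤q+r (d m) (d k) (½ * ε) (hN m k N≤m N≤k) ⟩
      d k + ½ * ε             ∎)))
    where open ≤-Reasoning

rational-below : ∀ y {η} → 0ℚ < η →
  ∃[ r ] fromℚ r <ᵣ y × Eventually (λ m → seq y m ≤ r + ι 3 * η)
rational-below y {η} 0<η with M , hM ← isCauchy y η 0<η =
  -- Of the two η subtracted, one absorbs the Cauchy error and the other keeps the inequality
  -- strict. A further Cauchy error above `seq y M` gives 3 η.
  seq y M - ι 2 * η ,
  (η , 0<η , M , λ m M≤m → ≤-shift (seq y M - ι 2 * η) η (seq y m) (begin
    seq y M - ι 2 * η + η
      ≤⟨ +-monoˡ-≤ η (+-monoˡ-≤ (- (ι 2 * η))
          (∣p-q∣<r⇒p≤q+r (seq y M) (seq y m) η (hM M m ℕ.≤-refl M≤m))) ⟩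
    seq y m + η - ι 2 * η + η     ≡⟨ cancel (seq y m) η ⟩
    seq y m                       ∎)) ,
  M , λ m M≤m → ≤-trans (∣p-q∣<r⇒p≤q+r (seq y m) (seq y M) η (hM m M M≤m ℕ.≤-refl))
      (≤-reflexive (split (seq y M) η))
  where
  open ≤-Reasoning
  open +-*-Solver
  cancel : ∀ p η → p + η - ι 2 * η + η ≡ p
  cancel = solve 2 (λ p η → p :+ η :- con (ι 2) :* η :+ η := p) refl
  split : ∀ p η → p + η ≡ p - ι 2 * η + ι 3 * η
  split = solve 2 (λ p η → p :+ η := p :- con (ι 2) :* η :+ con (ι 3) :* η) refl

<ᵣ⇒eventually : ∀ {x y} → x <ᵣ y → Eventually (λ m → seq x m ≤ seq y m)
<ᵣ⇒eventually {x} {y} (δ , 0<δ , K , hK) = K , λ m K≤m →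
  subst (_≤ seq y m) (+-identityʳ (seq x m))
      (≤-unshift (seq x m) 0ℚ (seq y m) (≤-trans (<⇒≤ 0<δ) (hK m K≤m)))

seq-^ᵣ : ∀ x k m → seq (x ^ᵣ k) m ≡ seq x m ^ℚ k
seq-^ᵣ x zero    m = refl
seq-^ᵣ x (suc k) m = cong (seq x m *_) (seq-^ᵣ x k m)

-- Growth of the pivots

module _ {α : ℝ} {δ} (0<δ : 0ℚ < δ) (δ≤ : Eventually λ m → δ ≤ seq α m - 1ℚ)
         {p : ℕ → ℕ} (pivots : IsPivots α p) where

  private
    G : ℕ → ℕ → ℚ
    G i = seq (geometricSum α i)

  -- Horner's form of the geometric sum, where the definition appends the highest power instead. It
  -- links each pivot to its predecessor.
  G-suc : ∀ i m → G (suc i) m ≡ 1ℚ + seq α m * G i m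
  G-suc zero    m = refl
  G-suc (suc i) m = begin
    G (suc i) m + a * seq (α ^ᵣ suc i) m          ≡⟨ cong (_+ a * seq (α ^ᵣ suc i) m) (G-suc i m) ⟩
    1ℚ + a * G i m + a * seq (α ^ᵣ suc i) m       ≡⟨ +-assoc 1ℚ (a * G i m) _ ⟩
    1ℚ + (a * G i m + a * seq (α ^ᵣ suc i) m)
      ≡⟨ cong (λ r → 1ℚ + r) (*-distribˡ-+ a (G i m) _) ⟨
    1ℚ + a * (G i m + seq (α ^ᵣ suc i) m)         ∎
    where
    open ≡-Reasoning
    a = seq α m

  1≤α : Eventually λ m → 1ℚ ≤ seq α m
  1≤α = eventually-map
    (λ m δ≤x → subst (_≤ seq α m) (+-identityʳ 1ℚ)
        (≤-unshift 1ℚ 0ℚ (seq α m) (≤-trans (<⇒≤ 0<δ) δ≤x))) δ≤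

  1≤α^ : ∀ i {m} → 1ℚ ≤ seq α m → 1ℚ ≤ seq (α ^ᵣ i) m
  1≤α^ zero        1≤a = ≤-refl
  1≤α^ (suc i) {m} 1≤a = *-mono-≤ {1ℚ} {seq α m} (nonNegative⁻¹ 1ℚ)
      (≤-trans (nonNegative⁻¹ 1ℚ) 1≤a) 1≤a (1≤α^ i 1≤a)

  -- The sum grows by a power of α, hence by at least 1, while p i stays below the old sum plus 1 by
  -- some ε. Comparing the new sum with the new pivot up to ε / 2 is then precise enough.
  pivots-< : ∀ i → p i ℕ.< p (suc i)
  pivots-< i with ε , 0<ε , K , hK ← proj₂ (pivots i) = ℕ.≰⇒> λ p′≤p →
    let m , (ε≤ , 1≤a) , G′≤ = eventually-∃ (eventually-× (eventually-× (K , hK) 1≤α)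
          (≤ᵣ⇒eventually {geometricSum α (suc i)} {fromℕ (p (suc i))} (proj₁ (pivots (suc i)))
              (½*-pos 0<ε)))
        open ≤-Reasoning
    in <-irrefl refl (begin-strict
      ι (p (suc i)) + ½ * ε         <⟨ +-monoʳ-< (ι (p (suc i))) (½*< 0<ε) ⟩
      ι (p (suc i)) + ε             ≤⟨ +-monoˡ-≤ ε (ι-mono-≤ {p (suc i)} {p i} p′≤p) ⟩
      ι (p i) + ε                   ≤⟨ ≤-unshift (ι (p i)) ε (G i m + 1ℚ) ε≤ ⟩
      G i m + 1ℚ                    ≤⟨ +-monoʳ-≤ (G i m) (1≤α^ (suc i) 1≤a) ⟩
      G (suc i) m                   ≤⟨ G′≤ ⟩
      ι (p (suc i)) + ½ * ε         ∎)
    where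
    ½*< : ∀ {ε} → 0ℚ < ε → ½ * ε < ε
    ½*< {ε} 0<ε = subst (½ * ε <_) (*-identityˡ ε)
        (*-monoˡ-<-pos ε {{positive 0<ε}} {½} {1ℚ} (*<* (ℤ.+<+ (ℕ.s≤s (ℕ.s≤s ℕ.z≤n)))))

  -- The term x + 3 collects 1 from `G-suc`, 1 from rounding up, and α = x + 1 from the tolerance 1
  -- allowed between the sum and p i.
  pivots-growth : ∀ i → Eventually λ m → let x = seq α m - 1ℚ in
    ι (p (suc i)) ≤ ι (p i) + (x * ι (p i) + (x + ι 3))
  pivots-growth i = eventually-map growth
    (eventually-× 1≤α (eventually-×
        (<ᵣ⇒eventually {fromℕ (p (suc i))} {geometricSum α (suc i) +ᵣ 1ℝ} (proj₂ (pivots (suc i))))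
                                    (≤ᵣ⇒eventually {geometricSum α i} {fromℕ (p i)}
                                        (proj₁ (pivots i)) (positive⁻¹ 1ℚ))))
    where
    open ≤-Reasoning
    expand : ∀ a q → 1ℚ + a * (q + 1ℚ) + 1ℚ ≡ q + ((a - 1ℚ) * q + (a - 1ℚ + ι 3))
    expand = solve 2 (λ a q → con 1ℚ :+ a :* (q :+ con 1ℚ) :+ con 1ℚ :=
      q :+ ((a :- con 1ℚ) :* q :+ (a :- con 1ℚ :+ con (ι 3)))) refl
      where open +-*-Solver

    growth : ∀ m → 1ℚ ≤ seq α m × (ι (p (suc i)) ≤ G (suc i) m + 1ℚ) × (G i m ≤ ι (p i) + 1ℚ) → _
    growth m (1≤a , p′≤ , G≤) = begin
      ι (p (suc i))                           ≤⟨ p′≤ ⟩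
      G (suc i) m + 1ℚ                        ≡⟨ cong (_+ 1ℚ) (G-suc i m) ⟩
      1ℚ + seq α m * G i m + 1ℚ
        ≤⟨ +-monoˡ-≤ 1ℚ (+-monoʳ-≤ 1ℚ
            (*-monoˡ-≤-nonNeg (seq α m) {{nonNegative (≤-trans (nonNegative⁻¹ 1ℚ) 1≤a)}} G≤)) ⟩
      1ℚ + seq α m * (ι (p i) + 1ℚ) + 1ℚ      ≡⟨ expand (seq α m) (ι (p i)) ⟩
      ι (p i) + ((seq α m - 1ℚ) * ι (p i) + (seq α m - 1ℚ + ι 3)) ∎

-- From 3 ≤ δ j ≤ x j and j + 1 ≤ p follows x + 3 ≤ x p, so the layer has at most 2 x p elements.
fraction-growth : ∀ {x δ c d j p p′} → ι c ≡ ι d * x → 0ℚ ≤ x → δ ≤ x → ι 3 ≤ δ * ι j → suc j ℕ.≤ p →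
  ι p′ ≤ ι p + (x * ι p + (x + ι 3)) → d ℕ.* (p′ ℕ.∸ p) ℕ.≤ 2 ℕ.* c ℕ.* p
fraction-growth {x} {δ} {c} {d} {j} {p} {p′} c≡dx 0≤x δ≤x 3≤δj j<p h = begin
  d ℕ.* (p′ ℕ.∸ p)                        ≡⟨ ℕ.*-distribˡ-∸ d p′ p ⟩
  d ℕ.* p′ ℕ.∸ d ℕ.* p                    ≤⟨ ℕ.m≤n+o⇒m∸n≤o (d ℕ.* p′) (d ℕ.* p) (ι-cancel-≤ dp′≤) ⟩
  2 ℕ.* c ℕ.* p                           ∎
  where
  x+3≤xp : x + ι 3 ≤ x * ι p
  x+3≤xp = begin
    x + ι 3           ≤⟨ +-monoʳ-≤ x 3≤δj ⟩
    x + δ * ι j       ≤⟨ +-monoʳ-≤ x (*-monoʳ-≤-nonNeg (ι j) {{nonNegative (0≤ι j)}} δ≤x) ⟩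
    x + x * ι j       ≡⟨ cong (_+ x * ι j) (*-identityʳ x) ⟨
    x * 1ℚ + x * ι j  ≡⟨ *-distribˡ-+ x 1ℚ (ι j) ⟨
    x * (1ℚ + ι j)    ≡⟨ cong (x *_) (ι-homo-+ 1 j) ⟨
    x * ι (suc j)     ≤⟨ *-monoˡ-≤-nonNeg x {{nonNegative 0≤x}} (ι-mono-≤ {suc j} {p} j<p) ⟩
    x * ι p           ∎
    where open ≤-Reasoning

  dp′≤ : ι (d ℕ.* p′) ≤ ι (d ℕ.* p ℕ.+ 2 ℕ.* c ℕ.* p)
  dp′≤ = begin
    ι (d ℕ.* p′)
      ≡⟨ ι-homo-* d p′ ⟩
    ι d * ι p′
      ≤⟨ *-monoˡ-≤-nonNeg (ι d) {{nonNegative (0≤ι d)}}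
          (≤-trans h (+-monoʳ-≤ (ι p) (+-monoʳ-≤ (x * ι p) x+3≤xp))) ⟩
    ι d * (ι p + (x * ι p + x * ι p))
      ≡⟨ expand (ι d) x (ι p) ⟩
    ι d * ι p + ι 2 * (ι d * x) * ι p
      ≡⟨ cong (λ r → ι d * ι p + ι 2 * r * ι p) c≡dx ⟨
    ι d * ι p + ι 2 * ι c * ι p
      ≡⟨ cong₂ _+_ (ι-homo-* d p) (trans (ι-homo-* (2 ℕ.* c) p) (cong (_* ι p) (ι-homo-* 2 c))) ⟨
    ι (d ℕ.* p) + ι (2 ℕ.* c ℕ.* p)
      ≡⟨ ι-homo-+ (d ℕ.* p) (2 ℕ.* c ℕ.* p) ⟨
    ι (d ℕ.* p ℕ.+ 2 ℕ.* c ℕ.* p) ∎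
    where
    open ≤-Reasoning
    expand : ∀ d x p → d * (p + (x * p + x * p)) ≡ d * p + ι 2 * (d * x) * p
    expand = solve 3 (λ d x p → d :* (p :+ (x :* p :+ x :* p)) := d :* p :+ con (ι 2) :*
        (d :* x) :* p) refl
      where open +-*-Solver

  open ℕ.≤-Reasoning

⊔-reciprocal : ∀ {δ x} (0<δ : 0ℚ < δ) → δ ≤ x →
  x * (1/ (δ ⊔ x)) {{>-nonZero (<-≤-trans 0<δ (p≤p⊔q δ x))}} ≡ 1ℚ
⊔-reciprocal {δ} {x} 0<δ δ≤x = trans
  (cong (_* (1/ (δ ⊔ x))) (sym (p≤q⇒p⊔q≡q δ≤x)))
  (*-inverseʳ (δ ⊔ x))
  where instance _ = >-nonZero (<-≤-trans 0<δ (p≤p⊔q δ x))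

0≤reciprocal : ∀ {x y} → 0ℚ < x → x * y ≡ 1ℚ → 0ℚ ≤ y
0≤reciprocal {x} {y} 0<x xy≡1 = *-cancelˡ-≤-pos x {{positive 0<x}}
  (≤-trans (≤-reflexive (*-zeroʳ x)) (≤-trans (nonNegative⁻¹ 1ℚ) (≤-reflexive (sym xy≡1))))

divide : ∀ {ε} → 0ℚ < ε → ∀ k .{{_ : ℕ.NonZero k}} → ∃[ η ] 0ℚ < η × η * ι k ≡ ε
divide {ε} 0<ε k = ε * (+ 1 / k) ,
  subst (_< ε * (+ 1 / k)) (*-zeroʳ ε)
      (*-monoʳ-<-pos ε {{positive 0<ε}} {0ℚ} {+ 1 / k} (positive⁻¹ _ {{normalize-pos 1 k}})) ,
  trans (*-assoc ε (+ 1 / k) (ι k)) (trans (cong (ε *_) (i/n*n≡i (+ 1) k)) (*-identityʳ ε))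

-- Refuting an excess of the bound over the runtime

module _ (α : ℝ) (1<α : 1ℝ <ᵣ α) (u v : ℝ)
         (log-u : IsLog₂ (1/ᵣ (α -ᵣ 1ℝ) 1<α) u) (log-v : IsLog₂ α v)
         (p : ℕ → ℕ) (pivots : IsPivots α p) where

  private
    δ = proj₁ 1<α
    0<δ = proj₁ (proj₂ 1<α)

    δ≤ : Eventually λ m → δ ≤ seq α m - 1ℚ
    δ≤ = proj₂ (proj₂ 1<α)

    p-< : ∀ i → p i ℕ.< p (suc i)
    p-< = pivots-< {α} 0<δ δ≤ {p} pivots

    -- Large enough for `fraction-growth` from layer `suc j` on. It is chosen from δ, and so depends
    -- neither on n nor on the index of the approximation.
    j = proj₁ (archimedean 0<δ 3)

    3≤δj : ι 3 ≤ δ * ι j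
    3≤δj = proj₂ (archimedean 0<δ 3)

    1/[α-1] : ℝ
    1/[α-1] = 1/ᵣ (α -ᵣ 1ℝ) 1<α

  module _ {n} (2p≤n : 2 ℕ.* p (suc j) ℕ.≤ n) (A : DecisionTree n) (lohifies : LOHifies p A)
           {T} (≤T : ∀ a → comparisons A a ℕ.≤ T)
           {ε} (0<ε : 0ℚ < ε) where

    private
      S = n ℕ.∸ p (suc j)

      p≤n : p (suc j) ℕ.≤ n
      p≤n = ℕ.≤-trans (ℕ.m≤m+n _ _) 2p≤n

      n≤2S : n ℕ.≤ 2 ℕ.* S
      n≤2S = begin
        n                                       ≡⟨ ℕ.m+n∸n≡m n n ⟨
        n ℕ.+ n ℕ.∸ n                           ≤⟨ ℕ.∸-monoʳ-≤ (n ℕ.+ n) 2p≤n ⟩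
        n ℕ.+ n ℕ.∸ 2 ℕ.* p (suc j)
          ≡⟨ cong (λ r → n ℕ.+ r ℕ.∸ 2 ℕ.* p (suc j)) (ℕ.+-identityʳ n) ⟨
        2 ℕ.* n ℕ.∸ 2 ℕ.* p (suc j)             ≡⟨ ℕ.*-distribˡ-∸ 2 n (p (suc j)) ⟨
        2 ℕ.* S                                 ∎
        where open ℕ.≤-Reasoning

      -- An upper bound for the factor 3 n (2 + y) in the error of `approximate-bound`, as y ≤ j;
      -- `suc n` keeps it nonzero, so that ε can be divided by it.
      k = 3 ℕ.* suc n ℕ.* (2 ℕ.+ j)

    contradiction-at : ∀ {a y u v r s η} {i l : ℤ} {b} →
      δ ≤ a - 1ℚ → (a - 1ℚ) * y ≡ 1ℚ → 0ℚ < η → η * ι k ≡ ε →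
      r ≡ i / suc b → s ≡ l / suc b →
      2^ i ≤ y ^ℚ suc b → 2^ l ≤ a ^ℚ suc b →
      u ≤ r + ι 3 * η → v ≤ s + ι 3 * η →
      (∀ i → i ℕ.< suc j ℕ.+ n →
        ι (p (suc i)) ≤ ι (p i) + ((a - 1ℚ) * ι (p i) + (a - 1ℚ + ι 3))) →
      ε ≤ (+ 1 / 8) * (ι n * u + ι n * a * v * y) - ι T → ⊥
    contradiction-at {a} {y} {u} {v} {r} {s} {η} {i} {l} {b}
      δ≤x xy≡1 0<η ηk≡ε refl refl 2^i≤ 2^l≤ u≤ v≤ growth ε≤ =
      from-fraction (positive-fraction 0<x)
      where
      x = a - 1ℚ

      0<x : 0ℚ < x
      0<x = <-≤-trans 0<δ δ≤x

      0≤y : 0ℚ ≤ y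
      0≤y = 0≤reciprocal 0<x xy≡1

      a≡1+x : a ≡ 1ℚ + x
      a≡1+x = solve 1 (λ a → a := con 1ℚ :+ (a :- con 1ℚ)) refl a
        where open +-*-Solver

      y≤j : y ≤ ι j
      y≤j = begin
        y                 ≡⟨ *-identityʳ y ⟨
        y * 1ℚ            ≤⟨ *-monoˡ-≤-nonNeg y {{nonNegative 0≤y}} (begin
          1ℚ                ≤⟨ ι-mono-≤ {1} {3} (ℕ.s≤s ℕ.z≤n) ⟩
          ι 3               ≤⟨ 3≤δj ⟩
          δ * ι j           ≤⟨ *-monoʳ-≤-nonNeg (ι j) {{nonNegative (0≤ι j)}} δ≤x ⟩
          x * ι j           ∎) ⟩
        y * (x * ι j)
          ≡⟨ trans (sym (*-assoc y x (ι j))) (cong (_* ι j) (trans (*-comm y x) xy≡1)) ⟩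
        1ℚ * ι j          ≡⟨ *-identityˡ (ι j) ⟩
        ι j               ∎
        where open ≤-Reasoning

      error≤ε : η * (ι 3 * ι n * (ι 2 + y)) ≤ ε
      error≤ε = begin
        η * (ι 3 * ι n * (ι 2 + y))
          ≤⟨ *-monoˡ-≤-nonNeg η {{nonNegative (<⇒≤ 0<η)}} (*-mono-≤
               (≤-trans (0≤ι 2) (subst (_≤ ι 2 + y) (+-identityʳ (ι 2)) (+-monoʳ-≤ (ι 2) 0≤y)))
               (*-nonNeg (0≤ι 3) (0≤ι (suc n)))
               (*-monoˡ-≤-nonNeg (ι 3) (ι-mono-≤ {n} {suc n} (ℕ.n≤1+n n)))
               (+-monoʳ-≤ (ι 2) y≤j)) ⟩
        η * (ι 3 * ι (suc n) * (ι 2 + ι j))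
          ≡⟨ cong (η *_) (trans (ι-homo-* (3 ℕ.* suc n) (2 ℕ.+ j))
              (cong₂ _*_ (ι-homo-* 3 (suc n)) (ι-homo-+ 2 j))) ⟨
        η * ι k
          ≡⟨ ηk≡ε ⟩
        ε ∎
        where open ≤-Reasoning

      -- The approximation error is at most ε and is scaled by 1 / 8 with the rest, so it cannot
      -- account for an excess of ε.
      from-bounds : (r + s) * ι S ≤ ι (2 ℕ.* T) → s * y * ι S ≤ ι (2 ℕ.* T) → ⊥
      from-bounds h₁ h₂ = <-irrefl refl (begin-strict
        ι T + ε
          ≤⟨ ≤-unshift (ι T) ε (C * F) ε≤ ⟩
        C * F
          ≤⟨ *-monoˡ-≤-nonNeg C (≤-trans
               (≤-reflexive (cong (λ a → ι n * u + ι n * a * v * y) a≡1+x))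
               (approximate-bound {n} {S} {T} {x} {y} {u} {v} {r} {s} {η} n≤2S xy≡1 (<⇒≤ 0<x) 0≤y
                   (<⇒≤ 0<η) u≤ v≤ h₁ h₂)) ⟩
        C * (ι 8 * ι T + η * (ι 3 * ι n * (ι 2 + y)))
          ≤⟨ *-monoˡ-≤-nonNeg C (+-monoʳ-≤ (ι 8 * ι T) error≤ε) ⟩
        C * (ι 8 * ι T + ε)
          ≡⟨ expand (ι T) ε ⟩
        ι T + C * ε
          <⟨ +-monoʳ-< (ι T) C*ε<ε ⟩
        ι T + ε ∎)
        where
        open ≤-Reasoning
        C = + 1 / 8
        F = ι n * u + ι n * a * v * y

        expand : ∀ t ε → C * (ι 8 * t + ε) ≡ t + C * ε
        expand = solve 2 (λ t ε → con C :* (con (ι 8) :* t :+ ε) := t :+ con C :* ε) refl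
          where open +-*-Solver

        C*ε<ε : C * ε < ε
        C*ε<ε = subst (C * ε <_) (*-identityˡ ε)
          (*-monoˡ-<-pos ε {{positive 0<ε}} {C} {1ℚ} (*<* (ℤ.+<+ (ℕ.s≤s (ℕ.s≤s ℕ.z≤n)))))

      from-fraction : ∃[ c ] ∃[ d ] ι (suc c) ≡ ι (suc d) * x → ⊥
      from-fraction (c , d , c≡dx) = from-bounds
        (ℚ-log-boundˢ {x} {y} {suc c} {suc d} c≡dx xy≡1 0≤y {S} {T} {suc b} i l
          (comparisons-boundˢ p p-< A lohifies {T} ≤T {suc c} {suc d} (suc j) p≤n growth′)
          2^i≤ 2^l≤′)
        (ℚ-log-boundᵠ {x} {y} {suc c} {suc d} c≡dx xy≡1 0≤y {S} {T} {suc b} l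
          (comparisons-boundᵠ p p-< A lohifies {T} ≤T {suc c} {suc d} (suc j) p≤n growth′)
          2^l≤′)
        where
        2^l≤′ : 2^ l ≤ (1ℚ + x) ^ℚ suc b
        2^l≤′ = subst (λ a → 2^ l ≤ a ^ℚ suc b) a≡1+x 2^l≤

        growth′ : ∀ i → suc j ℕ.≤ i → i ℕ.< suc j ℕ.+ n →
          suc d ℕ.* (p (suc i) ℕ.∸ p i) ℕ.≤ 2 ℕ.* suc c ℕ.* p i
        growth′ i j<i i< = fraction-growth {x} {δ} {suc c} {suc d} {j} {p i} {p (suc i)}
          c≡dx (<⇒≤ 0<x) δ≤x 3≤δj (ℕ.≤-trans j<i (i≤pᵢ p p-< i)) (growth i i<)

    -- The order of choices matters: η comes from ε, the rationals below u and v from η, their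
    -- exponents from a common denominator, and only then the index m at which all estimates hold
    -- together.
    runtime-bound : Eventually (λ m →
        ε ≤ (+ 1 / 8) * (ι n * seq u m + ι n * seq α m * seq v m * seq 1/[α-1] m) - ι T) → ⊥
    runtime-bound ε≤ =
      from-below (divide 0<ε k)
      where
      from-below : ∃[ η ] 0ℚ < η × η * ι k ≡ ε → ⊥
      from-below (η , 0<η , ηk≡ε) = go (rational-below u 0<η) (rational-below v 0<η)
        where
        go : ∃[ r ] fromℚ r <ᵣ u × Eventually (λ m → seq u m ≤ r + ι 3 * η) →
             ∃[ s ] fromℚ s <ᵣ v × Eventually (λ m → seq v m ≤ s + ι 3 * η) → ⊥
        go (r , r<u , u≤) (s , s<v , v≤) = with-exponents (common-denominator r s)
          where
          with-exponents : ∃[ i ] ∃[ l ] ∃[ b ] r ≡ i / suc b × s ≡ l / suc b → ⊥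
          with-exponents (i , l , b , r≡ , s≡) = at (eventually-∃
            (eventually-× δ≤ (eventually-× 2^i≤ (eventually-× 2^l≤ (eventually-× u≤ (eventually-× v≤
              (eventually-× growth ε≤)))))))
            where
            2^i≤ : Eventually λ m → 2^ i ≤ seq (1/[α-1] ^ᵣ suc b) m
            2^i≤ = <ᵣ⇒eventually {fromℚ (2^ i)} {1/[α-1] ^ᵣ suc b}
              (proj₁ (log-u i (suc b)) (subst (λ r → fromℚ r <ᵣ u) r≡ r<u))

            2^l≤ : Eventually λ m → 2^ l ≤ seq (α ^ᵣ suc b) m
            2^l≤ = <ᵣ⇒eventually {fromℚ (2^ l)} {α ^ᵣ suc b}
              (proj₁ (log-v l (suc b)) (subst (λ s → fromℚ s <ᵣ v) s≡ s<v))

            Growth : ℕ → ℕ → Set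
            Growth i m = ι (p (suc i)) ≤ ι (p i) + ((seq α m - 1ℚ) * ι (p i) + (seq α m - 1ℚ + ι 3))

            growth : Eventually λ m → ∀ i → i ℕ.< suc j ℕ.+ n → Growth i m
            -- Each pivot has its own starting index, so a common one exists only for finitely many
            -- of them; those below `suc j + n` cover the array.
            growth = eventually-∀< {Growth} (pivots-growth {α} 0<δ δ≤ {p} pivots) (suc j ℕ.+ n)

            at : ∃[ m ] (δ ≤ seq α m - 1ℚ) × (2^ i ≤ seq (1/[α-1] ^ᵣ suc b) m) ×
              (2^ l ≤ seq (α ^ᵣ suc b) m) × (seq u m ≤ r + ι 3 * η) × (seq v m ≤ s + ι 3 * η) ×
              (∀ i → i ℕ.< suc j ℕ.+ n → Growth i m) ×
              (ε ≤ (+ 1 / 8) * (ι n * seq u m + ι n * seq α m * seq v m * seq 1/[α-1] m) - ι T) → ⊥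
            at (m , δ≤x , 2^i≤y^b , 2^l≤a^b , u≤m , v≤m , growth-m , ε≤m) =
              contradiction-at {seq α m} {seq 1/[α-1] m} {seq u m} {seq v m} {r} {s} {η} {i} {l} {b}
                δ≤x (⊔-reciprocal 0<δ δ≤x) 0<η ηk≡ε r≡ s≡
                (subst (2^ i ≤_) (seq-^ᵣ 1/[α-1] (suc b) m) 2^i≤y^b)
                (subst (2^ l ≤_) (seq-^ᵣ α (suc b) m) 2^l≤a^b)
                u≤m v≤m growth-m ε≤m

theorem2p1 : ∃[ C ] 0ℝ <ᵣ C × (∀ (α : ℝ) (1<α : 1ℝ <ᵣ α) →
    ∀ (u v : ℝ) → IsLog₂ (1/ᵣ (α -ᵣ 1ℝ) 1<α) u → IsLog₂ α v →
    ∀ (p : ℕ → ℕ) → IsPivots α p →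
    LOHRuntime≥ p C (bound α 1<α u v))
theorem2p1 = fromℚ (+ 1 / 8) , (+ 1 / 8 , positive⁻¹ (+ 1 / 8) , 0 , λ _ _ → ≤-refl) ,
  -- The threshold for n, inferred from `2p≤n`, is `2 * p (suc j)`: the single initial colour then
  -- takes at most half of the array. Since `≤ᵣ` is a negation, an excess ε is given and has to be
  -- refuted.
  λ α 1<α u v log-u log-v p pivots → _ , λ n 2p≤n A lohifies T (≤T , _) (ε , 0<ε , ε≤) →
    runtime-bound α 1<α u v log-u log-v p pivots 2p≤n A lohifies ≤T 0<ε ε≤
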